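{- Let $d$ and $k$ be fixed positive integers. Algorithm 1 (the dynamic program specified in the context), run on a vertex-weighted narrow $d$-dimensional Line of Sight network $G=(V,E,w)$ with parameters $n$, $k$ and $\omega$, given with its embedding, computes a maximum independent set of $G$ (an independent set of largest possible total weight) in time $$O\left(n\,\bigl(k^{(d-1)/\omega}\,\omega\bigr)^{k^{d-1}}\right).$$
   Context: **Networks.** For positive integers $d,k,n$, a narrow cube $\mathbb{Z}^d_{n,k}$ is $\{1,\dots,n\}\times\{1,\dots,x_1\}\times\cdots\times\{1,\dots,x_{d-1}\}$, where the $x_i$ are positive integers bounded by $k$, a constant independent of $n$. Two distinct points share a line of sight if their coordinates differ in a single place. A weighted graph $G=(V,E,w)$, with $w$ assigning a positive weight to each vertex, is a narrow $d$-dimensional Line of Sight (LoS) network with parameters $n,k$ and range parameter $\omega$ (a positive integer) if there is an embedding $f_G:V\to\mathbb{Z}^d_{n,k}$ such that $\{u,v\}\in E$ if and only if $f_G(u)$ and $f_G(v)$ share a line of sight and their Manhattan distance is less than $\omega$. **Arrays.** Arrays are $d$-dimensional tables of non-negative numbers with entries $A[\mathbf{i},j]$, where $\mathbf{i}=(i_1,\dots,i_{d-1})\in\{1,\dots,k\}^{d-1}$ is the row index and $j$ the column index. $A[j_1:j_2]$ is the sub-array of columns $j_1,\dots,j_2$, and $A[j]$ is column $j$. For arrays of the same size, $A_1\le_a A_2$ means $A_1[\mathbf{i},j]\le A_2[\mathbf{i},j]$ for all $\mathbf{i},j$. $A_1\vDash A_2$ ("$A_1$ is consistent with $A_2$") means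 that $A_1$ without its first column equals $A_2$ without its last column. The network $G$ is identified with the array, also called $G$, with rows $\mathbf{i}\in\{1,\dots,k\}^{d-1}$ and columns $j\in\{ -(\omega-1),\dots,n\}$, where $G[\mathbf{i},j]=w(v)$ if $(j,\mathbf{i})$ is the location of a vertex $v$, and $G[\mathbf{i},j]=0$ otherwise; in particular all columns $j\le 0$ are zero. **Feasible arrays.** $\mathcal{F}$ is the set of feasible arrays: the $0/1$ arrays $W$ with rows $\{1,\dots,k\}^{d-1}$ and $\omega$ columns whose non-zero entries are the non-zero entries of an independent array with $\omega$ columns. That is, two non-zero entries in the same row lie in columns at distance at least $\omega$, and two non-zero entries in the same column have row indices which either do not share a line of sight or do but differ by at least $\omega$ in the differing coordinate. For each $j$, $\mathcal{F}_{G,j}$ is the set of $W\in\mathcal{F}$ with $W\le_a G[j-\omega+1:j]$. **Algorithm 1.** 1. Initialisation: set $\mathrm{MIS}[0,\vec 0]=0$, where $\vec 0$ is the all-zero array with $\omega$ columns; set $\mathrm{MIS}[j,W]=0$ for all $j=1,\dots,n$ and $W\in\mathcal{F}$. 2. For $j=1,\dots,n$ and for each $W\in\mathcal{F}_{G,j}$: let $W^*\in\mathcal{F}_{G,j-1}$ with $W^*\vDash W$ maximize $\mathrm{MIS}[j-1,W^*]$; set $\mathrm{MIS}[j,W]=\langle W[\omega],G[j]\rangle+\mathrm{MIS}[j-1,W^*]$, where $\langle\cdot,\cdot\rangle$ is the Frobenius product (sum of products of corresponding entries) of the last column $W[\omega]$ of $W$ with column $j$ of $G$; set $\mathrm{pred}[j,W]=W^*$.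 3. Retrieval: find $W^*\in\mathcal{F}_{G,n}$ maximizing $\mathrm{MIS}[n,W^*]$ and let $I$ be the rightmost column of $W^*$. For $j=n$ down to $2$: replace $W^*$ by $\mathrm{pred}[j,W^*]$, then redefine $I$ as the rightmost column of this new $W^*$ concatenated with $I$. Return $I$; its non-zero entries mark the vertices of the computed independent set.
   Formalization: In the definition of F_{G,j}, W is compared with the support of G rather than with G itself, since otherwise vertices of weight below 1 could never be selected and the claim fails; weights lie in any totally ordered commutative ring with decidable order. -}

module Defs where

open import Algebra.Bundles using (CommutativeRing)
open import Algebra.Structures using (IsCommutativeRing)
open import Data.Bool using (Bool; true; false; if_then_else_)
open import Data.Empty using (⊥-elim)
open import Data.Fin using (Fin; zero; suc; toℕ; finToFun)
open import Data.Fin.Properties using (any?; all?) renaming (_≟_ to _≟ᶠ_)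
open import Data.Fin.Subset using (Subset; _∈_)
open import Data.List as List using (List; []; _∷_)
open import Data.Nat using (ℕ; zero; suc; _+_; _*_; _∸_; _^_; _≤_; _<_; _≤ᵇ_; ∣_-_∣)
open import Data.Nat.Properties using () renaming (_≟_ to _≟ℕ_)
open import Data.Nat.ListAction using () renaming (sum to List-sum)
open import Data.Product using (∃; _×_; _,_; proj₁; proj₂)
open import Data.Sum using (_⊎_; inj₁; inj₂)
open import Data.Vec as Vec using (Vec; []; _∷_; lookup; tabulate; replicate; _∷ʳ_)
open import Data.Vec.Properties using (≡-dec)
open import Data.Vec.Relation.Binary.Pointwise.Inductive using (Pointwise)
open import Data.Vec.Relation.Unary.All using (All)
open import Function using (_⇔_; mk⇔)
open import Level using (0ℓ)
open import Relation.Binary.PropositionalEquality using (_≡_; _≢_; refl; sym; subst)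
open import Relation.Binary.Structures using (IsDecTotalOrder)
open import Relation.Nullary using (¬_; Dec; yes; no; does; ¬?)
open import Relation.Nullary.Decidable using (_×-dec_; _→-dec_; ⌊_⌋)

-- The numbers used for weights and array entries: any totally ordered
-- commutative ring with decidable order (ℤ, ℚ, and classically ℝ).
record OrderedRing : Set₁ where
  infix  4 _≤ⁿ_
  infixl 6 _+ⁿ_
  infixl 7 _*ⁿ_
  field
    Carrier           : Set
    _+ⁿ_ _*ⁿ_         : Carrier → Carrier → Carrier
    -ⁿ_               : Carrier → Carrier
    0# 1#             : Carrier
    _≤ⁿ_              : Carrier → Carrier → Set
    isCommutativeRing : IsCommutativeRing _≡_ _+ⁿ_ _*ⁿ_ -ⁿ_ 0# 1#
    isDecTotalOrder   : IsDecTotalOrder _≡_ _≤ⁿ_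
    +-monoʳ-≤         : ∀ a {b c} → b ≤ⁿ c → a +ⁿ b ≤ⁿ a +ⁿ c
    *-nonneg          : ∀ {a b} → 0# ≤ⁿ a → 0# ≤ⁿ b → 0# ≤ⁿ a *ⁿ b
    0≢1               : 0# ≢ 1#

  commutativeRing : CommutativeRing 0ℓ 0ℓ
  commutativeRing = record { isCommutativeRing = isCommutativeRing }

  open CommutativeRing commutativeRing public using (+-commutativeMonoid)
  open import Algebra.Properties.CommutativeMonoid.Sum +-commutativeMonoid public using (sum)
  open IsDecTotalOrder isDecTotalOrder public using () renaming (_≟_ to _≟ⁿ_; _≤?_ to _≤ⁿ?_)

  Positive : Carrier → Set
  Positive a = 0# ≤ⁿ a × a ≢ 0#

------------------------------------------------------------------------
-- Line of Sight networks

Point : ℕ → Set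
Point d = Vec ℕ d

DifferOnlyAt : ∀ {d} → Fin d → Point d → Point d → Set
DifferOnlyAt i p q = lookup p i ≢ lookup q i × (∀ j → j ≢ i → lookup p j ≡ lookup q j)

LineOfSight : ∀ {d} → Point d → Point d → Set
LineOfSight p q = ∃ λ i → DifferOnlyAt i p q

manhattan : ∀ {d} → Point d → Point d → ℕ
manhattan p q = Vec.sum (Vec.zipWith ∣_-_∣ p q)

_Within_ : ℕ → ℕ → Set
x Within m = 1 ≤ x × x ≤ m

record WeightedGraph (R : OrderedRing) : Set₁ where
  open OrderedRing R using (Carrier; Positive; 0#; sum)
  field
    order  : ℕ
    Edge   : Fin order → Fin order → Set
    symm   : ∀ {u v} → Edge u v → Edge v u
    irrefl : ∀ {v} → ¬ Edge v v
    w      : Fin order → Carrier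
    w>0    : ∀ v → Positive (w v)

  Independent : Subset order → Set
  Independent S = ∀ {u v} → u ∈ S → v ∈ S → ¬ Edge u v

  weight : Subset order → Carrier
  weight S = sum (λ v → if lookup S v then w v else 0#)

  MaximumIndependent : Subset order → Set
  MaximumIndependent S =
    Independent S × (∀ T → Independent T → OrderedRing._≤ⁿ_ R (weight T) (weight S))

-- A network together with its embedding; its dimension is d = suc d-1, and
-- the narrow cube is {1,…,n} × {1,…,x₁} × ⋯ × {1,…,x_{d-1}} with xᵢ ≤ k.
record LoSNetwork (R : OrderedRing) (d-1 k n ω : ℕ) : Set₁ where
  field
    graph : WeightedGraph R
  open WeightedGraph graph public
  field
    widths      : Vec ℕ d-1
    widths≤k    : All (_Within k) widths
    f           : Fin order → Point (suc d-1)
    f-in-cube   : ∀ v → Pointwise _Within_ (f v) (n ∷ widths)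
    f-injective : ∀ {u v} → f u ≡ f v → u ≡ v
    edge⇔       : ∀ u v → Edge u v ⇔ (LineOfSight (f u) (f v) × manhattan (f u) (f v) < ω)

------------------------------------------------------------------------
-- Arrays

-- The row index (i₁,…,i_{d-1}) ∈ {1,…,k}^{d-1} is numbered by the library
-- bijection between Fin (k ^ d-1) and Fin d-1 → Fin k.
Row : ℕ → ℕ → Set
Row d-1 k = Fin (k ^ d-1)

coords : ∀ d-1 k → Row d-1 k → Point d-1
coords d-1 k r = tabulate (λ i → suc (toℕ (finToFun {k} {d-1} r i)))

module Arrays (R : OrderedRing) (d-1 k : ℕ) where
  open OrderedRing R

  Column : Set
  Column = Vec Carrier (k ^ d-1)

  Array : ℕ → Set
  Array c = Vec Column c

  infix 20 _[_,_]
  _[_,_] : ∀ {c} → Array c → Row d-1 k → Fin c → Carrier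
  A [ r , j ] = lookup (lookup A j) r

  infix 4 _≤ₐ_ _⊨_
  _≤ₐ_ : ∀ {c} → Array c → Array c → Set
  A ≤ₐ B = ∀ r j → A [ r , j ] ≤ⁿ B [ r , j ]

  _⊨_ : ∀ {c} → Array (suc c) → Array (suc c) → Set
  A ⊨ B = Vec.tail A ≡ Vec.init B

  ⟨_,_⟩ : Column → Column → Carrier
  ⟨ a , b ⟩ = sum (λ r → lookup a r *ⁿ lookup b r)

  zeros : ∀ c → Array c
  zeros c = replicate c (replicate _ 0#)

  ZeroOne : ∀ {c} → Array c → Set
  ZeroOne A = ∀ r j → A [ r , j ] ≡ 0# ⊎ A [ r , j ] ≡ 1#

  record Feasible {ω} (W : Array ω) : Set where
    field
      zero-one    : ZeroOne W
      same-row    : ∀ r j j′ → j ≢ j′ → W [ r , j ] ≢ 0# → W [ r , j′ ] ≢ 0# →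
                    ω ≤ ∣ toℕ j - toℕ j′ ∣
      same-column : ∀ j r r′ → W [ r , j ] ≢ 0# → W [ r′ , j ] ≢ 0# →
                    ∀ i → DifferOnlyAt i (coords d-1 k r) (coords d-1 k r′) →
                    ω ≤ ∣ lookup (coords d-1 k r) i - lookup (coords d-1 k r′) i ∣

  indicator : Carrier → Carrier
  indicator a = if does (a ≟ⁿ 0#) then 0# else 1#

  supp : ∀ {c} → Array c → Array c
  supp = Vec.map (Vec.map indicator)

module NetworkArray
  {R : OrderedRing} {d-1 k n ω-1 : ℕ} (G : LoSNetwork R d-1 k n (suc ω-1)) where
  open OrderedRing R
  open LoSNetwork G
  open Arrays R d-1 k

  at : Point (suc d-1) → Carrier
  at p with any? (λ v → ≡-dec _≟ℕ_ (f v) p)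
  ... | yes (v , _) = w v
  ... | no  _       = 0#

  -- Columns -(ω-1),…,n of G are numbered 0,…,n+ω-1, so column j of G is
  -- col (j + ω-1).  For j ≤ 0 the first coordinate is truncated to 0, which is
  -- outside the narrow cube, so the column is zero.
  col : ℕ → Column
  col c = tabulate (λ r → at ((c ∸ ω-1) ∷ coords d-1 k r))

  column : ℕ → Column
  column j = col (j + ω-1)

  -- G[j-ω+1 : j]
  window : ℕ → Array (suc ω-1)
  window j = tabulate (λ c → col (j + toℕ c))

  -- 𝓕_{G,j}.  The comparison with G only says which entries of W may be
  -- non-zero; it is made against the support of G, so that it also does so when
  -- some weights are less than 1 (cf. ≤ₐ-supp below).
  FeasibleAt : ℕ → Array (suc ω-1) → Set
  FeasibleAt j W = Feasible W × W ≤ₐ supp (window j)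

  -- The non-zero entries of I are exactly the locations of the vertices in S.
  Marks : Array n → Subset order → Set
  Marks I S = ∀ r j →
    I [ r , j ] ≢ 0# ⇔ (∃ λ v → v ∈ S × f v ≡ suc (toℕ j) ∷ coords d-1 k r)

  MarksMaximumIndependentSet : Array n → Set
  MarksMaximumIndependentSet I = ∃ λ S → Marks I S × MaximumIndependent S

-- When the non-zero entries of A are at least 1 (e.g. integer weights),
-- comparing a 0/1 array with A or with its support is the same.
module _ (R : OrderedRing) (d-1 k : ℕ) where
  open OrderedRing R
  open Arrays R d-1 k
  open import Data.Vec.Properties using (lookup-map)

  private
    open IsDecTotalOrder isDecTotalOrder using (antisym; total; reflexive) renaming (refl to ≤ⁿ-refl)
    open CommutativeRing commutativeRing using (zeroʳ; *-identityˡ; -‿inverseˡ; +-identityʳ; ring)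
    open import Algebra.Properties.Ring ring using (-‿distribˡ-*; -‿distribʳ-*; -‿involutive)

    0≤1 : 0# ≤ⁿ 1#
    0≤1 with total 0# 1#
    ... | inj₁ p = p
    ... | inj₂ 1≤0 = subst (0# ≤ⁿ_) [-1]²≡1 (*-nonneg 0≤-1 0≤-1)
      where
      open Relation.Binary.PropositionalEquality using (trans; cong)
      0≤-1 : 0# ≤ⁿ -ⁿ 1#
      0≤-1 = subst (_≤ⁿ -ⁿ 1#) (-‿inverseˡ 1#)
               (subst (-ⁿ 1# +ⁿ 1# ≤ⁿ_) (+-identityʳ (-ⁿ 1#)) (+-monoʳ-≤ (-ⁿ 1#) 1≤0))
      [-1]²≡1 : (-ⁿ 1#) *ⁿ (-ⁿ 1#) ≡ 1#
      [-1]²≡1 = trans (sym (-‿distribˡ-* 1# (-ⁿ 1#)))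
                  (trans (cong -ⁿ_ (*-identityˡ (-ⁿ 1#))) (-‿involutive 1#))

    entry⇔ : ∀ {x a} → x ≡ 0# ⊎ x ≡ 1# → a ≡ 0# ⊎ 1# ≤ⁿ a → x ≤ⁿ a ⇔ x ≤ⁿ indicator a
    entry⇔ {x} {a} x01 a≥ with a ≟ⁿ 0#
    ... | yes refl = mk⇔ (λ p → p) (λ p → p)
    ... | no a≢0 = mk⇔ (λ _ → to1 x01) (λ _ → toa x01 a≥)
      where
      trans≤ = IsDecTotalOrder.trans isDecTotalOrder
      to1 : x ≡ 0# ⊎ x ≡ 1# → x ≤ⁿ 1#
      to1 (inj₁ refl) = 0≤1
      to1 (inj₂ refl) = ≤ⁿ-refl
      toa : x ≡ 0# ⊎ x ≡ 1# → a ≡ 0# ⊎ 1# ≤ⁿ a → x ≤ⁿ a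
      toa _ (inj₁ a≡0) = ⊥-elim (a≢0 a≡0)
      toa p (inj₂ 1≤a) = trans≤ (to1 p) 1≤a

    supp-entry : ∀ {c} (A : Array c) r j → supp A [ r , j ] ≡ indicator (A [ r , j ])
    supp-entry A r j rewrite lookup-map j (Vec.map indicator) A = lookup-map r indicator (lookup A j)

  ≤ₐ-supp : ∀ {c} (W A : Array c) → ZeroOne W →
            (∀ r j → A [ r , j ] ≡ 0# ⊎ 1# ≤ⁿ A [ r , j ]) →
            W ≤ₐ A ⇔ W ≤ₐ supp A
  ≤ₐ-supp W A W01 A≥ = mk⇔
    (λ p r j → subst (W [ r , j ] ≤ⁿ_) (sym (supp-entry A r j))
                 (Function.Equivalence.to (entry⇔ (W01 r j) (A≥ r j)) (p r j)))
    (λ p r j → Function.Equivalence.from (entry⇔ (W01 r j) (A≥ r j))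
                 (subst (W [ r , j ] ≤ⁿ_) (supp-entry A r j) (p r j)))

------------------------------------------------------------------------
-- Executions of the dynamic program; the choices of the maximizing W* are
-- arbitrary.

record Run {R : OrderedRing} {d-1 k n-1 ω-1 : ℕ}
           (G : LoSNetwork R d-1 k (suc n-1) (suc ω-1)) : Set where
  open OrderedRing R
  open Arrays R d-1 k
  open NetworkArray G

  private
    n = suc n-1
    ω = suc ω-1

  field
    MIS  : ℕ → Array ω → Carrier
    pred : ℕ → Array ω → Array ω

    MIS-start   : MIS 0 (zeros ω) ≡ 0#
    MIS-default : ∀ j W → 1 ≤ j → j ≤ n → Feasible W → ¬ FeasibleAt j W → MIS j W ≡ 0#

    pred-feasible   : ∀ j W → j < n → FeasibleAt (suc j) W → FeasibleAt j (pred (suc j) W)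
    pred-consistent : ∀ j W → j < n → FeasibleAt (suc j) W → pred (suc j) W ⊨ W
    pred-maximal    : ∀ j W → j < n → FeasibleAt (suc j) W →
                      ∀ W′ → FeasibleAt j W′ → W′ ⊨ W → MIS j W′ ≤ⁿ MIS j (pred (suc j) W)
    MIS-step        : ∀ j W → j < n → FeasibleAt (suc j) W →
                      MIS (suc j) W ≡ ⟨ Vec.last W , column (suc j) ⟩ +ⁿ MIS j (pred (suc j) W)

    final          : Array ω
    final-feasible : FeasibleAt n final
    final-maximal  : ∀ W′ → FeasibleAt n W′ → MIS n W′ ≤ⁿ MIS n final

  -- retrieve j W* is the part of I in columns 1,…,j+1, when W* is the array
  -- reached for column j+1.
  retrieve : ∀ j → Array ω → Array (suc j)
  retrieve zero    W* = Vec.last W* ∷ []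
  retrieve (suc j) W* = retrieve j (pred (suc (suc j)) W*) ∷ʳ Vec.last W*

  output : Array n
  output = retrieve n-1 final

------------------------------------------------------------------------
-- A first-order language with unit-cost operations.
--
-- Programs are terms that are parametric in the type V of variables, hence
-- cannot inspect run-time values other than by the operations below.  Each
-- operation costs one step, each iteration of a loop one step in addition to
-- its body.  Values other than words, numbers and booleans are references:
-- records with a fixed number of fields, arrays with random access (created by
-- a loop that fills in all cells), and linked lists.  An access outside an
-- array, and the head of an empty list, yield a default value.

infixr 5 _⊗_
infix  6 _⋆_

data Ty : Set where
  word num bool : Ty
  _⊗_           : Ty → Ty → Ty
  _⋆_           : Ty → ℕ → Ty
  arr list      : Ty → Ty

infixl 6 _+ʷ_ _∸ʷ_ _+′_
infixl 7 _*′_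
infix  4 _≤ʷ_ _≤′_
infixl 8 _!_

data Exp (V : Ty → Set) : Ty → Set where
  var       : ∀ {τ} → V τ → Exp V τ
  bind      : ∀ {σ τ} → Exp V σ → (V σ → Exp V τ) → Exp V τ
  lit       : ℕ → Exp V word
  _+ʷ_ _∸ʷ_ : Exp V word → Exp V word → Exp V word
  _≤ʷ_      : Exp V word → Exp V word → Exp V bool
  zero′ one′ : Exp V num
  _+′_ _*′_ : Exp V num → Exp V num → Exp V num
  _≤′_      : Exp V num → Exp V num → Exp V bool
  tt′ ff′   : Exp V bool
  cond      : ∀ {τ} → Exp V bool → Exp V τ → Exp V τ → Exp V τ
  pair      : ∀ {σ τ} → Exp V σ → Exp V τ → Exp V (σ ⊗ τ)
  fst       : ∀ {σ τ} → Exp V (σ ⊗ τ) → Exp V σ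
  snd       : ∀ {σ τ} → Exp V (σ ⊗ τ) → Exp V τ
  tuple     : ∀ {τ m} → (Fin m → Exp V τ) → Exp V (τ ⋆ m)
  proj      : ∀ {τ m} → Fin m → Exp V (τ ⋆ m) → Exp V τ
  fill      : ∀ {τ} → Exp V word → (V word → Exp V τ) → Exp V (arr τ)
  _!_       : ∀ {τ} → Exp V (arr τ) → Exp V word → Exp V τ
  nil       : ∀ {τ} → Exp V (list τ)
  cons      : ∀ {τ} → Exp V τ → Exp V (list τ) → Exp V (list τ)
  head      : ∀ {τ} → Exp V (list τ) → Exp V τ
  tail      : ∀ {τ} → Exp V (list τ) → Exp V (list τ)
  loop      : ∀ {σ} → Exp V word → Exp V σ → (V word → V σ → Exp V σ) → Exp V σ

module Semantics (R : OrderedRing) where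
  open OrderedRing R

  ⟦_⟧ : Ty → Set
  ⟦ word ⟧   = ℕ
  ⟦ num ⟧    = Carrier
  ⟦ bool ⟧   = Bool
  ⟦ σ ⊗ τ ⟧  = ⟦ σ ⟧ × ⟦ τ ⟧
  ⟦ τ ⋆ m ⟧  = Vec ⟦ τ ⟧ m
  ⟦ arr τ ⟧  = List ⟦ τ ⟧
  ⟦ list τ ⟧ = List ⟦ τ ⟧

  default : ∀ τ → ⟦ τ ⟧
  default word     = 0
  default num      = 0#
  default bool     = false
  default (σ ⊗ τ)  = default σ , default τ
  default (τ ⋆ m)  = replicate m (default τ)
  default (arr τ)  = []
  default (list τ) = []

  nth : ∀ τ → List ⟦ τ ⟧ → ℕ → ⟦ τ ⟧
  nth τ []       i       = default τ
  nth τ (x ∷ xs) zero    = x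
  nth τ (x ∷ xs) (suc i) = nth τ xs i

  rest : ∀ {A : Set} → List A → List A
  rest []       = []
  rest (x ∷ xs) = xs

  iterate : ∀ {A : Set} → ℕ → A → (ℕ → A → A) → A
  iterate zero    z s = z
  iterate (suc m) z s = s m (iterate m z s)

  value : ∀ {τ} → Exp ⟦_⟧ τ → ⟦ τ ⟧
  value (var x)      = x
  value (bind e b)   = value (b (value e))
  value (lit c)      = c
  value (e +ʷ e′)    = value e + value e′
  value (e ∸ʷ e′)    = value e ∸ value e′
  value (e ≤ʷ e′)    = value e ≤ᵇ value e′
  value zero′        = 0#
  value one′         = 1#
  value (e +′ e′)    = value e +ⁿ value e′
  value (e *′ e′)    = value e *ⁿ value e′
  value (e ≤′ e′)    = ⌊ value e ≤ⁿ? value e′ ⌋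
  value tt′          = true
  value ff′          = false
  value (cond e t u) = if value e then value t else value u
  value (pair e e′)  = value e , value e′
  value (fst e)      = proj₁ (value e)
  value (snd e)      = proj₂ (value e)
  value (tuple es)   = tabulate (λ r → value (es r))
  value (proj r e)   = lookup (value e) r
  value (fill e b)   = List.applyUpTo (λ i → value (b i)) (value e)
  value (_!_ {τ} e i) = nth τ (value e) (value i)
  value nil          = []
  value (cons e e′)  = value e ∷ value e′
  value (head {τ} e) = nth τ (value e) 0
  value (tail e)     = rest (value e)
  value (loop e z b) = iterate (value e) (value z) (λ i s → value (b i s))

  cost : ∀ {τ} → Exp ⟦_⟧ τ → ℕ
  cost (var x)      = 1
  cost (bind e b)   = 1 + cost e + cost (b (value e))
  cost (lit c)      = 1
  cost (e +ʷ e′)    = 1 + cost e + cost e′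
  cost (e ∸ʷ e′)    = 1 + cost e + cost e′
  cost (e ≤ʷ e′)    = 1 + cost e + cost e′
  cost zero′        = 1
  cost one′         = 1
  cost (e +′ e′)    = 1 + cost e + cost e′
  cost (e *′ e′)    = 1 + cost e + cost e′
  cost (e ≤′ e′)    = 1 + cost e + cost e′
  cost tt′          = 1
  cost ff′          = 1
  cost (cond e t u) = 1 + cost e + (if value e then cost t else cost u)
  cost (pair e e′)  = 1 + cost e + cost e′
  cost (fst e)      = 1 + cost e
  cost (snd e)      = 1 + cost e
  cost (tuple es)   = 1 + Vec.sum (tabulate (λ r → cost (es r)))
  cost (proj r e)   = 1 + cost e
  cost (fill e b)   = 1 + cost e + List-sum (List.applyUpTo (λ i → 1 + cost (b i)) (value e))
  cost (e ! i)      = 1 + cost e + cost i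
  cost nil          = 1
  cost (cons e e′)  = 1 + cost e + cost e′
  cost (head e)     = 1 + cost e
  cost (tail e)     = 1 + cost e
  cost (loop e z b) = 1 + cost e + cost z +
    List-sum (List.applyUpTo
      (λ i → 1 + cost (b i (iterate i (value z) (λ i s → value (b i s))))) (value e))

------------------------------------------------------------------------
-- The dynamic program in this language, for fixed d and k

Table : ℕ → Ty → Ty
Table zero    τ = τ
Table (suc m) τ = arr (Table m τ)

module _ {V : Ty → Set} where

  infixr 3 _and_
  infixr 2 _or_

  _and_ _or_ : Exp V bool → Exp V bool → Exp V bool
  e and e′ = cond e e′ ff′
  e or  e′ = cond e tt′ e′

  every : ∀ {m} → (Fin m → Exp V bool) → Exp V bool
  every {zero}  es = tt′
  every {suc m} es = es zero and every (λ r → es (suc r))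

  total : ∀ {m} → (Fin m → Exp V num) → Exp V num
  total {zero}  es = zero′
  total {suc m} es = es zero +′ total (λ r → es (suc r))

  nonzero : Exp V num → Exp V bool
  nonzero e = cond (e ≤′ zero′) ff′ tt′

  select : ∀ {τ m} → Exp V (Table m τ) → Vec (Exp V word) m → Exp V τ
  select t []       = t
  select t (i ∷ is) = select (t ! i) is

  -- fillAll and loopAll range over all m-tuples of words less than b.
  fillAll : ∀ {τ} m → Exp V word → (Vec (V word) m → Exp V τ) → Exp V (Table m τ)
  fillAll zero    b e = e []
  fillAll (suc m) b e = fill b (λ i → fillAll m b (λ is → e (i ∷ is)))

  loopAll : ∀ {σ} m → Exp V word → Exp V σ → (Vec (V word) m → V σ → Exp V σ) → Exp V σ
  loopAll zero    b z e = bind z (e [])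
  loopAll (suc m) b z e = loop b z (λ i s → loopAll m b (var s) (λ is → e (i ∷ is)))

DifferOnlyAt? : ∀ {d} i (p q : Point d) → Dec (DifferOnlyAt i p q)
DifferOnlyAt? i p q =
  ¬? (lookup p i ≟ℕ lookup q i) ×-dec
  all? (λ j → ¬? (j ≟ᶠ i) →-dec (lookup p j ≟ℕ lookup q j))

-- A feasible array has at most one non-zero entry in each row, and is
-- represented by its code: the column (1,…,ω) of that entry for each row, or 0
-- if the row is zero.
module Program (d-1 k : ℕ) {V : Ty → Set} (n ω : V word) (G : V (arr num ⋆ (k ^ d-1))) where

  K : ℕ
  K = k ^ d-1

  Code : Ty
  Code = word ⋆ K

  -- MIS[j,W] and pred[j,W] for fixed j, indexed by the code of W
  Tab : Ty
  Tab = Table K (num ⊗ Code)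

  at : V Code → Fin K → Exp V word
  at W r = proj r (var W)

  infix 8 _‼_
  _‼_ : Exp V Tab → V Code → Exp V (num ⊗ Code)
  T ‼ W = select T (tabulate (at W))

  zeroCode : Exp V Code
  zeroCode = tuple (λ _ → lit 0)

  feasible : V Code → Exp V bool
  feasible W = every λ r → every λ r′ → every λ i → compatible r r′ i
    where
    p : Fin K → Point d-1
    p = coords d-1 k
    compatible : Fin K → Fin K → Fin d-1 → Exp V bool
    compatible r r′ i =
      if does (DifferOnlyAt? i (p r) (p r′))
      then (at W r ≤ʷ lit 0)
           or (at W r +ʷ lit 1 ≤ʷ at W r′)
           or (at W r′ +ʷ lit 1 ≤ʷ at W r)
           or (var ω ≤ʷ lit ∣ lookup (p r) i - lookup (p r′) i ∣)
      else tt′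

  feasibleAt : Exp V word → V Code → Exp V bool
  feasibleAt j W = feasible W and every λ r →
    (at W r ≤ʷ lit 0) or nonzero (proj r (var G) ! (j +ʷ at W r ∸ʷ lit 1))

  lastColumn : V Code → Exp V (num ⋆ K)
  lastColumn W = tuple λ r → cond (var ω ≤ʷ at W r) one′ zero′

  -- The arrays W* ⊨ W are obtained by shifting W to the right by one column and
  -- choosing 0 or 1 in the first column for each row that is zero after the shift.
  predecessor : V Code → (Fin K → Exp V word) → Exp V Code
  predecessor W b = tuple λ r →
    cond ((lit 1 ≤ʷ at W r) and (at W r +ʷ lit 1 ≤ʷ var ω)) (at W r +ʷ lit 1) (b r)

  -- Replace the current best W* by W if W ∈ 𝓕_{G,j} and MIS[j,W] is larger.
  improve : Exp V word → V Tab → V Code → V (num ⊗ Code) → Exp V (num ⊗ Code)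
  improve j T W best =
    cond (feasibleAt j W)
      (bind (fst (var T ‼ W)) λ x →
        cond (var x ≤′ fst (var best)) (var best) (pair (var x) (var W)))
      (var best)

  -- The loop may start from the shift of W with zero first column, which is in
  -- 𝓕_{G,j} whenever W ∈ 𝓕_{G,j+1}.
  bestPredecessor : V word → V Tab → V Code → Exp V (num ⊗ Code)
  bestPredecessor j T W =
    loopAll K (lit 2)
      (bind (predecessor W (λ _ → lit 0)) λ W₀ → pair (fst (var T ‼ W₀)) (var W₀))
      (λ b best → bind (predecessor W (λ r → var (lookup b r))) λ W* → improve (var j) T W* best)

  gain : Exp V word → V Code → Exp V num
  gain j W = bind (lastColumn W) λ c →
    total λ r → proj r (var c) *′ (proj r (var G) ! (j +ʷ var ω ∸ʷ lit 1))

  allCodes : ∀ {τ} → (V Code → Exp V τ) → Exp V (Table K τ)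
  allCodes e = fillAll K (var ω +ʷ lit 1) λ c → bind (tuple (λ r → var (lookup c r))) e

  start : Exp V Tab
  start = allCodes λ _ → pair zero′ zeroCode

  -- From the table T for column j to the table for column j+1.
  step : V word → V Tab → Exp V Tab
  step j T = allCodes λ W →
    cond (feasibleAt (var j +ʷ lit 1) W)
      (bind (bestPredecessor j T W) λ best →
        pair (gain (var j +ʷ lit 1) W +′ fst (var best)) (snd (var best)))
      (pair zero′ zeroCode)

  -- The tables for columns n,…,0, in this order.
  tables : Exp V (list Tab)
  tables = loop (var n) (cons start nil) λ j Ts →
    bind (head (var Ts)) λ T → cons (step j T) (var Ts)

  finalCode : V Tab → Exp V Code
  finalCode T = snd (loopAll K (var ω +ʷ lit 1)
    (bind zeroCode λ W₀ → pair (fst (var T ‼ W₀)) (var W₀))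
    (λ c best → bind (tuple (λ r → var (lookup c r))) λ W → improve (var n) T W best))

  retrieval : V (list Tab) → V Code → Exp V (list (num ⋆ K))
  retrieval Ts W* =
    snd (snd (loop (var n ∸ʷ lit 1)
      (pair (var Ts) (pair (var W*) (cons (lastColumn W*) nil)))
      λ _ s →
        bind (fst (var s)) λ Ts′ →
        bind (fst (snd (var s))) λ W →
        bind (snd (head (var Ts′) ‼ W)) λ W′ →
        pair (tail (var Ts′)) (pair (var W′) (cons (lastColumn W′) (snd (snd (var s)))))))

  algorithm : Exp V (list (num ⋆ K))
  algorithm =
    bind tables λ Ts →
    bind (head (var Ts)) λ T →
    bind (finalCode T) λ W* →
    retrieval Ts W*

module Execution {R : OrderedRing} {d-1 k n ω-1 : ℕ} (G : LoSNetwork R d-1 k n (suc ω-1)) where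
  open OrderedRing R
  open Semantics R
  open Arrays R d-1 k
  open NetworkArray G

  -- The array G, as one array of n + ω entries for each row.
  input : ⟦ arr num ⋆ (k ^ d-1) ⟧
  input = tabulate λ r → List.applyUpTo (λ c → lookup (col c) r) (n + suc ω-1)

  term : Exp ⟦_⟧ (list (num ⋆ (k ^ d-1)))
  term = Program.algorithm d-1 k n (suc ω-1) input

  result : List Column
  result = value term

  time : ℕ
  time = cost term

-- t ≤ C · n · (k^((d-1)/ω) · ω)^(k^(d-1)), with both sides raised to the
-- power ω, as k^((d-1)/ω) need not be rational.
TimeBound : (C d-1 k n ω t : ℕ) → Set
TimeBound C d-1 k n ω t =
  t ^ ω ≤ (C * n * ω ^ (k ^ d-1)) ^ ω * (k ^ d-1) ^ (k ^ d-1)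

{-# OPTIONS --safe #-}
module Submission where

-- An array of 𝓕_{G,j} is the trace of an independent set on the ω columns ending at column j, and
-- every line of sight shorter than ω between columns ≤ j and column j is visible in that window.
-- Hence MIS[j,W] is the largest weight of an independent set in columns ≤ j with trace W, by
-- induction on j: a chain of consistent windows glues to an independent set of weight MIS[j,W],
-- and the windows of any independent set form a chain of candidates for the maximizations.
-- In the program a feasible array is given by the position of the unique 1 in each row, so there
-- are (ω+1)^(k^(d-1)) ≤ (2ω)^(k^(d-1)) codes per column, each handled in time bounded in d and k.

open import Defs
open import Algebra.Bundles using (CommutativeRing)
open import Data.Bool using (Bool; true; false; if_then_else_)
open import Data.Bool.Properties using (T-≡)
open import Data.Empty using (⊥; ⊥-elim)
open import Data.Fin using (Fin; zero; suc; toℕ; fromℕ; fromℕ<; inject₁; funToFin; finToFun; combine)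
open import Data.Fin.Properties using (any?; toℕ-injective; toℕ<n; toℕ-fromℕ; toℕ-fromℕ<; toℕ-inject₁; toℕ≤pred[n]; funToFin-finToFin; finToFun-funToFin; suc-injective) renaming (_≟_ to _≟ᶠ_)
open import Data.Fin.Relation.Unary.Top using (view; ‵fromℕ; ‵inject₁)
open import Data.Fin.Subset using (Subset; _∈_) renaming (⊥ to ∅)
open import Data.Fin.Subset.Properties using (_∈?_; ∉⊥)
open import Data.List as List using (List; []; _∷_; _++_)
open import Data.List.Properties using (++-assoc; ++-identityʳ)
open import Data.Nat as ℕ using (ℕ; zero; suc; _+_; _*_; _∸_; _^_; _≤_; _<_; _≤ᵇ_; z≤n; s≤s; s≤s⁻¹; _≤?_; ∣_-_∣; _⊓_; _⊔_; NonZero; >-nonZero)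
open import Data.Nat.ListAction using () renaming (sum to List-sum)
open import Data.Nat.Properties renaming (+-monoʳ-≤ to ℕ-+-monoʳ-≤; suc-injective to ℕ-suc-injective)
open import Data.Nat.Tactic.RingSolver using (solve-∀)
open import Data.Product using (∃; _×_; _,_; proj₁; proj₂)
open import Data.Sum using (_⊎_; inj₁; inj₂; [_,_]′)
open import Data.Unit using (⊤; tt)
open import Data.Vec as Vec using (Vec; []; _∷_; lookup; tabulate; _∷ʳ_; toList)
open import Data.Vec.Properties using (≡-dec; lookup-map; lookup∘tabulate; tabulate∘lookup; tabulate-cong; []=⇒lookup; lookup⇒[]=; lookup-replicate; toList-∷ʳ)
open import Data.Vec.Relation.Binary.Pointwise.Inductive as Pointwise using (_∷_)
open import Data.Vec.Relation.Unary.All using (All; _∷_)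
open import Function using (_⇔_; mk⇔; _∘_; Equivalence)
open import Relation.Binary.Definitions using (tri<; tri≈; tri>)
open import Relation.Binary.PropositionalEquality using (_≡_; _≢_; refl; sym; trans; cong; cong₂; subst; subst₂; module ≡-Reasoning)
open import Relation.Binary.Structures using (IsDecTotalOrder)
open import Relation.Nullary using (¬_; Dec; yes; no; does; ¬?; contradiction)
open import Relation.Nullary.Decidable using (_×-dec_; _⊎-dec_; ⌊_⌋)

open Equivalence using (to; from)

-- Maximizers need not be unique, so optimality is proved for an arbitrary `Run`, and the program is
-- only shown to realise one of them.
--
-- A window has exactly ω columns, so any two of its columns are closer than ω and `same-row` allows
-- at most one non-zero entry per row. This is why one number per row encodes a feasible array. All
-- entries being 0 or 1, array equalities reduce to equality of supports.
--
-- Truncated subtraction sends all columns left of the network to column 0, so several window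
-- columns may name the same location there. No vertex has column 0, and each argument about
-- distances first has to establish that a vertex is present.
--
-- An array consistent with a given `W` is determined by `W` except in its first column. With K =
-- k^(d-1) rows, each maximization therefore ranges over at most 2^K candidates whatever ω is, which
-- keeps the work per code bounded in d and k.

module _ {A : Set} where

  lookup-ext : ∀ {n} {xs ys : Vec A n} → (∀ i → lookup xs i ≡ lookup ys i) → xs ≡ ys
  lookup-ext {xs = xs} {ys} eq =
    trans (sym (tabulate∘lookup xs)) (trans (tabulate-cong eq) (tabulate∘lookup ys))

  lookup²∘tabulate² : ∀ {m n} (g : Fin m → Fin n → A) i j →
                      lookup (lookup (tabulate (λ i → tabulate (g i))) i) j ≡ g i j
  lookup²∘tabulate² g i j =
    trans (cong (λ X → lookup X j) (lookup∘tabulate (λ i → tabulate (g i)) i)) (lookup∘tabulate (g i) j)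

  last-lookup : ∀ {n} (xs : Vec A (suc n)) → Vec.last xs ≡ lookup xs (fromℕ n)
  last-lookup (x ∷ [])     = refl
  last-lookup (x ∷ y ∷ ys) = last-lookup (y ∷ ys)

  lookup-init : ∀ {n} (xs : Vec A (suc n)) i → lookup (Vec.init xs) i ≡ lookup xs (inject₁ i)
  lookup-init (x ∷ y ∷ ys) zero    = refl
  lookup-init (x ∷ y ∷ ys) (suc i) = lookup-init (y ∷ ys) i

  lookup-tail : ∀ {n} (xs : Vec A (suc n)) i → lookup (Vec.tail xs) i ≡ lookup xs (suc i)
  lookup-tail (x ∷ xs) i = refl

  lookup-∷ʳ-last : ∀ {n} (xs : Vec A n) y → lookup (xs ∷ʳ y) (fromℕ n) ≡ y
  lookup-∷ʳ-last []       y = refl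
  lookup-∷ʳ-last (x ∷ xs) y = lookup-∷ʳ-last xs y

  lookup-∷ʳ-inject₁ : ∀ {n} (xs : Vec A n) y i → lookup (xs ∷ʳ y) (inject₁ i) ≡ lookup xs i
  lookup-∷ʳ-inject₁ (x ∷ xs) y zero    = refl
  lookup-∷ʳ-inject₁ (x ∷ xs) y (suc i) = lookup-∷ʳ-inject₁ xs y i

∣toℕ-toℕ∣<n : ∀ {n} (i j : Fin n) → ∣ toℕ i - toℕ j ∣ < n
∣toℕ-toℕ∣<n i j = ≤-<-trans (∣m-n∣≤m⊔n (toℕ i) (toℕ j)) (⊔-pres-<m (toℕ<n i) (toℕ<n j))

fromDec : ∀ {n} {P : Fin n → Set} → (∀ v → Dec (P v)) → Subset n
fromDec P? = tabulate (λ v → does (P? v))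

∈-fromDec : ∀ {n} {P : Fin n → Set} (P? : ∀ v → Dec (P v)) {v} → v ∈ fromDec P? ⇔ P v
∈-fromDec {P = P} P? {v} = mk⇔
  (λ v∈ → sound (P? v) (trans (sym (lookup∘tabulate _ v)) ([]=⇒lookup v∈)))
  (λ Pv → lookup⇒[]= v _ (trans (lookup∘tabulate _ v) (complete (P? v) Pv)))
  where
  sound : (d : Dec (P v)) → does d ≡ true → P v
  sound (yes p) _ = p
  complete : (d : Dec (P v)) → P v → does d ≡ true
  complete (yes _) _ = refl
  complete (no ¬p) p = contradiction p ¬p

-- Distances along a line of sight and the numbering of rows

manhattan-refl : ∀ {d} (p q : Point d) → (∀ j → lookup p j ≡ lookup q j) → manhattan p q ≡ 0
manhattan-refl []      []      eq = refl
manhattan-refl (x ∷ p) (y ∷ q) eq =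
  cong₂ _+_ (m≡n⇒∣m-n∣≡0 (eq zero)) (manhattan-refl p q (λ j → eq (suc j)))

-- All other summands vanish. This translates between the Manhattan distance in `edge⇔` and the
-- single coordinate difference in `Feasible`.
manhattan-DifferOnlyAt : ∀ {d} i (p q : Point d) → DifferOnlyAt i p q →
                         manhattan p q ≡ ∣ lookup p i - lookup q i ∣
manhattan-DifferOnlyAt zero (x ∷ p) (y ∷ q) (_ , eq) =
  trans (cong (∣ x - y ∣ +_) (manhattan-refl p q (λ j → eq (suc j) (λ ())))) (+-identityʳ _)
manhattan-DifferOnlyAt (suc i) (x ∷ p) (y ∷ q) (neq , eq) =
  cong₂ _+_ (m≡n⇒∣m-n∣≡0 (eq zero (λ ())))
    (manhattan-DifferOnlyAt i p q (neq , λ j j≢i → eq (suc j) (j≢i ∘ suc-injective)))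

funToFin-cong : ∀ {m n} {g h : Fin m → Fin n} → (∀ i → g i ≡ h i) → funToFin g ≡ funToFin h
funToFin-cong {zero}  eq = refl
funToFin-cong {suc m} eq = cong₂ combine (eq zero) (funToFin-cong (λ i → eq (suc i)))

-- Equal points give coordinate functions that agree only pointwise, so the inverse `funToFin` is
-- applied through `funToFin-cong`.
coords-injective : ∀ d-1 k {r r′} → coords d-1 k r ≡ coords d-1 k r′ → r ≡ r′
coords-injective d-1 k {r} {r′} eq = begin
  r                                ≡⟨ funToFin-finToFin {d-1} {k} r ⟨
  funToFin (finToFun {k} {d-1} r)  ≡⟨ funToFin-cong {d-1} coordinate ⟩
  funToFin (finToFun {k} {d-1} r′) ≡⟨ funToFin-finToFin {d-1} {k} r′ ⟩
  r′                               ∎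
  where
  open ≡-Reasoning
  coordinate : ∀ i → finToFun {k} {d-1} r i ≡ finToFun r′ i
  coordinate i = toℕ-injective (cong ℕ.pred (begin
    suc (toℕ (finToFun {k} {d-1} r i))  ≡⟨ lookup∘tabulate _ i ⟨
    lookup (coords d-1 k r) i           ≡⟨ cong (λ p → lookup p i) eq ⟩
    lookup (coords d-1 k r′) i          ≡⟨ lookup∘tabulate _ i ⟩
    suc (toℕ (finToFun {k} {d-1} r′ i)) ∎))

coords-surjective : ∀ d-1 k (p : Point d-1) → (∀ i → lookup p i Within k) →
                    ∃ λ r → p ≡ coords d-1 k r
coords-surjective d-1 k p within = funToFin g , lookup-ext λ i → begin
    lookup p i                                ≡⟨ value-g i ⟨
    suc (toℕ (g i))                           ≡⟨ cong (suc ∘ toℕ) (finToFun-funToFin g i) ⟨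
    suc (toℕ (finToFun (funToFin g) i))       ≡⟨ lookup∘tabulate _ i ⟨
    lookup (coords d-1 k (funToFin g)) i      ∎
  where
  open ≡-Reasoning
  suc-pred′ : ∀ {x} → 1 ≤ x → suc (ℕ.pred x) ≡ x
  suc-pred′ (s≤s _) = refl
  bound : ∀ i → ℕ.pred (lookup p i) < k
  bound i = subst (_≤ k) (sym (suc-pred′ (proj₁ (within i)))) (proj₂ (within i))
  g : Fin d-1 → Fin k
  g i = fromℕ< (bound i)
  value-g : ∀ i → suc (toℕ (g i)) ≡ lookup p i
  value-g i = trans (cong suc (toℕ-fromℕ< (bound i))) (suc-pred′ (proj₁ (within i)))

-- Ordered rings and 0/1 entries

module OrderedRingProperties (R : OrderedRing) where
  open OrderedRing R
  private module CR = CommutativeRing commutativeRing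
  open import Algebra.Properties.Ring CR.ring using (-‿distribˡ-*; -‿involutive)
  open import Algebra.Properties.CommutativeMonoid.Sum +-commutativeMonoid using (sum-replicate-zero; sum-cong-≗)
  open IsDecTotalOrder isDecTotalOrder public using () renaming (refl to ≤ⁿ-refl; trans to ≤ⁿ-trans; antisym to ≤ⁿ-antisym; total to ≤ⁿ-total; reflexive to ≤ⁿ-reflexive)

  0≤1 : 0# ≤ⁿ 1#
  0≤1 with ≤ⁿ-total 0# 1#
  ... | inj₁ 0≤1 = 0≤1
  -- If 1 ≤ 0 then -1 is non-negative, and so is its square, which is 1.
  ... | inj₂ 1≤0 = subst (0# ≤ⁿ_) [-1]²≡1 (*-nonneg 0≤-1 0≤-1)
    where
    0≤-1 : 0# ≤ⁿ -ⁿ 1#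
    0≤-1 = subst₂ _≤ⁿ_ (CR.-‿inverseˡ 1#) (CR.+-identityʳ _) (+-monoʳ-≤ (-ⁿ 1#) 1≤0)
    [-1]²≡1 : (-ⁿ 1#) *ⁿ (-ⁿ 1#) ≡ 1#
    [-1]²≡1 = trans (sym (-‿distribˡ-* 1# (-ⁿ 1#)))
                (trans (cong -ⁿ_ (CR.*-identityˡ (-ⁿ 1#))) (-‿involutive 1#))

  -- The Iverson bracket of `P` multiplied by `a`; it lets sums over a column be written as sums
  -- over all vertices.
  infix 9 _·_
  _·_ : ∀ {P : Set} → Dec P → Carrier → Carrier
  P? · a = if does P? then a else 0#

  ·-yes : ∀ {P : Set} (P? : Dec P) a → P → P? · a ≡ a
  ·-yes (yes _) a p = refl
  ·-yes (no ¬p) a p = contradiction p ¬p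

  ·-no : ∀ {P : Set} (P? : Dec P) a → ¬ P → P? · a ≡ 0#
  ·-no (yes p) a ¬p = contradiction p ¬p
  ·-no (no _)  a ¬p = refl

  IsBit : Carrier → Set
  IsBit x = x ≡ 0# ⊎ x ≡ 1#

  bit : Bool → Carrier
  bit b = if b then 1# else 0#

  bit-isBit : ∀ b → IsBit (bit b)
  bit-isBit false = inj₁ refl
  bit-isBit true  = inj₂ refl

  bit-does : ∀ {P : Set} (P? : Dec P) → bit (does P?) ≢ 0# ⇔ P
  bit-does (yes p) = mk⇔ (λ _ → p) (λ _ → 0≢1 ∘ sym)
  bit-does (no ¬p) = mk⇔ (λ ≢0 → contradiction refl ≢0) (λ p → contradiction p ¬p)

  -- Equalities of traces, windows and decoded arrays are proved entrywise through this reduction to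
  -- supports.
  isBit-ext : ∀ {x y} → IsBit x → IsBit y → x ≢ 0# ⇔ y ≢ 0# → x ≡ y
  isBit-ext (inj₁ refl) (inj₁ refl) _ = refl
  isBit-ext (inj₁ refl) (inj₂ refl) e = contradiction refl (from e (0≢1 ∘ sym))
  isBit-ext (inj₂ refl) (inj₁ refl) e = contradiction refl (to e (0≢1 ∘ sym))
  isBit-ext (inj₂ refl) (inj₂ refl) _ = refl

  isBit-≤ : ∀ {x y} → IsBit x → IsBit y → (x ≢ 0# → y ≢ 0#) ⇔ x ≤ⁿ y
  isBit-≤ (inj₁ refl) (inj₁ refl) = mk⇔ (λ _ → ≤ⁿ-refl) (λ _ ≢0 → ≢0)
  isBit-≤ (inj₁ refl) (inj₂ refl) = mk⇔ (λ _ → 0≤1) (λ _ ≢0 → contradiction refl ≢0)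
  isBit-≤ (inj₂ refl) (inj₁ refl) =
    mk⇔ (λ h → contradiction refl (h (0≢1 ∘ sym))) (λ 1≤0 _ → 0≢1 ∘ λ _ → ≤ⁿ-antisym 0≤1 1≤0)
  isBit-≤ (inj₂ refl) (inj₂ refl) = mk⇔ (λ _ → ≤ⁿ-refl) (λ _ ≢0 → ≢0)

  indicator-isBit : ∀ {d-1 k} a → IsBit (Arrays.indicator R d-1 k a)
  indicator-isBit a with a ≟ⁿ 0#
  ... | yes _ = inj₁ refl
  ... | no  _ = inj₂ refl

  indicator-≢0 : ∀ {d-1 k} a → Arrays.indicator R d-1 k a ≢ 0# ⇔ a ≢ 0#
  indicator-≢0 a with a ≟ⁿ 0#
  ... | yes a≡0 = mk⇔ (λ ≢0 → contradiction refl ≢0) (λ a≢0 → contradiction a≡0 a≢0)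
  ... | no  a≢0 = mk⇔ (λ _ → a≢0) (λ _ → 0≢1 ∘ sym)

  sum-zero : ∀ {n} (t : Fin n → Carrier) → (∀ i → t i ≡ 0#) → sum t ≡ 0#
  sum-zero {n} t t≡0 = trans (sum-cong-≗ t≡0) (sum-replicate-zero n)

  sum-single : ∀ {n} (t : Fin n → Carrier) i → (∀ j → j ≢ i → t j ≡ 0#) → sum t ≡ t i
  sum-single {suc n} t zero t≡0 =
    trans (cong (t zero +ⁿ_) (sum-zero _ (λ j → t≡0 (suc j) (λ ())))) (CR.+-identityʳ _)
  sum-single {suc n} t (suc i) t≡0 =
    trans (cong₂ _+ⁿ_ (t≡0 zero (λ ())) (sum-single _ i (λ j j≢i → t≡0 (suc j) (j≢i ∘ suc-injective))))
          (CR.+-identityˡ _)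

-- Windows of vertex sets

module NetworkProperties
  {R : OrderedRing} {d-1 k n ω-1 : ℕ} (G : LoSNetwork R d-1 k n (suc ω-1)) where
  open OrderedRing R
  open OrderedRingProperties R
  private module CR = CommutativeRing commutativeRing
  open import Algebra.Properties.CommutativeMonoid.Sum +-commutativeMonoid using (sum-cong-≗; ∑-comm; ∑-distrib-+)
  open LoSNetwork G
  open Arrays R d-1 k
  open NetworkArray G

  ω K : ℕ
  ω = suc ω-1
  K = k ^ d-1

  -- The location in the network of entry (r , c) of G[j-ω+1 : j]
  location : ℕ → Fin K → Fin ω → Point (suc d-1)
  location j r c = (j + toℕ c ∸ ω-1) ∷ coords d-1 k r

  ⊨-entries : (A B : Array ω) →
              A ⊨ B ⇔ (∀ r c → A [ r , suc c ] ≡ B [ r , inject₁ c ])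
  ⊨-entries A B = mk⇔
    (λ eq r c → cong (λ X → lookup X r)
       (trans (sym (lookup-tail A c)) (trans (cong (λ X → lookup X c) eq) (lookup-init B c))))
    (λ eq → lookup-ext λ c → trans (lookup-tail A c)
       (trans (lookup-ext λ r → eq r c) (sym (lookup-init B c))))

  supp-window : ∀ j r c → supp (window j) [ r , c ] ≡ indicator (at (location j r c))
  supp-window j r c = begin
    lookup (lookup (supp (window j)) c) r
      ≡⟨ cong (λ X → lookup X r) (lookup-map c (Vec.map indicator) (window j)) ⟩
    lookup (Vec.map indicator (lookup (window j) c)) r
      ≡⟨ lookup-map r indicator (lookup (window j) c) ⟩
    indicator (lookup (lookup (window j) c) r)
      ≡⟨ cong indicator (lookup²∘tabulate² (λ c r → at (location j r c)) c r) ⟩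
    indicator (at (location j r c)) ∎
    where open ≡-Reasoning

  -- Both arrays are 0/1, where the order of entries is inclusion of supports. With `at-≢0` it says
  -- that `W` is non-zero only at locations of vertices.
  ≤ₐ-window : ∀ j W → ZeroOne W →
              W ≤ₐ supp (window j) ⇔ (∀ r c → W [ r , c ] ≢ 0# → at (location j r c) ≢ 0#)
  ≤ₐ-window j W W01 = mk⇔
    (λ W≤ r c → to (indicator-≢0 {d-1} {k} _) ∘
       from (isBit-≤ (W01 r c) (indicator-isBit {d-1} {k} _))
         (subst (W [ r , c ] ≤ⁿ_) (supp-window j r c) (W≤ r c)))
    (λ h r c → subst (W [ r , c ] ≤ⁿ_) (sym (supp-window j r c))
       (to (isBit-≤ (W01 r c) (indicator-isBit {d-1} {k} _))
         (from (indicator-≢0 {d-1} {k} _) ∘ h r c)))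

  at-vertex : ∀ v → at (f v) ≡ w v
  at-vertex v with any? (λ u → ≡-dec _≟_ (f u) (f v))
  ... | yes (u , fu≡fv) = cong w (f-injective fu≡fv)
  ... | no  none        = contradiction (v , refl) none

  at-empty : ∀ p → (∀ v → f v ≢ p) → at p ≡ 0#
  at-empty p none with any? (λ u → ≡-dec _≟_ (f u) p)
  ... | yes (u , fu≡p) = contradiction fu≡p (none u)
  ... | no  _          = refl

  at-nonneg : ∀ p → 0# ≤ⁿ at p
  at-nonneg p with any? (λ u → ≡-dec _≟_ (f u) p)
  ... | yes (u , _) = proj₁ (w>0 u)
  ... | no  _       = ≤ⁿ-refl

  -- Positivity of the weights is what makes presence of a vertex visible in the array.
  at-≢0 : ∀ p → at p ≢ 0# ⇔ (∃ λ v → f v ≡ p)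
  at-≢0 p with any? (λ u → ≡-dec _≟_ (f u) p)
  ... | yes (u , fu≡p) = mk⇔ (λ _ → u , fu≡p) (λ _ → proj₂ (w>0 u))
  ... | no  none       = mk⇔ (λ ≢0 → contradiction refl ≢0) (λ e → contradiction e none)

  column-of : Fin order → ℕ
  column-of v = Vec.head (f v)

  column-within : ∀ v → column-of v Within n
  column-within v with f v | f-in-cube v
  ... | _ ∷ _ | within ∷ _ = within

  row-of : ∀ v → ∃ λ r → f v ≡ column-of v ∷ coords d-1 k r
  row-of v with f v | f-in-cube v
  ... | x ∷ p | _ ∷ within = proj₁ s , cong (x ∷_) (proj₂ s)
    where
    widths-within : ∀ {m} {xs : Vec ℕ m} → All (_Within k) xs → ∀ i → lookup xs i ≤ k
    widths-within ((_ , ≤k) ∷ _) zero    = ≤k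
    widths-within (_ ∷ all)      (suc i) = widths-within all i
    s = coords-surjective d-1 k p λ i →
          proj₁ (Pointwise.lookup within i) ,
          ≤-trans (proj₂ (Pointwise.lookup within i)) (widths-within widths≤k i)

  Occupied : Subset order → Point (suc d-1) → Set
  Occupied S p = ∃ λ v → v ∈ S × f v ≡ p

  occupied? : ∀ S p → Dec (Occupied S p)
  occupied? S p = any? (λ v → (v ∈? S) ×-dec ≡-dec _≟_ (f v) p)

  mark : Subset order → Point (suc d-1) → Carrier
  mark S p = bit (does (occupied? S p))

  mark-isBit : ∀ S p → IsBit (mark S p)
  mark-isBit S p = bit-isBit _

  mark-≢0 : ∀ S p → mark S p ≢ 0# ⇔ Occupied S p
  mark-≢0 S p = bit-does (occupied? S p)

  mark-cong : ∀ {S S′ p} → Occupied S p ⇔ Occupied S′ p → mark S p ≡ mark S′ p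
  mark-cong {S} {S′} {p} e = isBit-ext (mark-isBit S p) (mark-isBit S′ p) (mk⇔
    (from (mark-≢0 S′ p) ∘ to e ∘ to (mark-≢0 S p))
    (from (mark-≢0 S p) ∘ from e ∘ to (mark-≢0 S′ p)))

  -- The trace of `S` on the window ending at column `j`. It is defined for every `S`, including
  -- vertices to the right of `j`.
  markWindow : Subset order → ℕ → Array ω
  markWindow S j = tabulate λ c → tabulate λ r → mark S (location j r c)

  markWindow-entry : ∀ S j r c → markWindow S j [ r , c ] ≡ mark S (location j r c)
  markWindow-entry S j r c =
    lookup²∘tabulate² (λ c r → mark S (location j r c)) c r

  markWindow-≢0 : ∀ S j r c → markWindow S j [ r , c ] ≢ 0# ⇔ Occupied S (location j r c)
  markWindow-≢0 S j r c rewrite markWindow-entry S j r c = mark-≢0 S _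

  markWindow-zeroOne : ∀ S j → ZeroOne (markWindow S j)
  markWindow-zeroOne S j r c rewrite markWindow-entry S j r c = mark-isBit S _

  location-last : ∀ j r → location j r (fromℕ ω-1) ≡ j ∷ coords d-1 k r
  location-last j r = cong (_∷ coords d-1 k r)
    (trans (cong (λ c → j + c ∸ ω-1) (toℕ-fromℕ ω-1)) (m+n∸n≡m j ω-1))

  -- Advancing the window by one column moves each cell one place to the left; this matches the
  -- index shift in `⊨-entries`.
  location-suc : ∀ j r (c : Fin ω-1) → location j r (suc c) ≡ location (suc j) r (inject₁ c)
  location-suc j r c = cong (λ x → (x ∸ ω-1) ∷ coords d-1 k r)
    (trans (+-suc j (toℕ c)) (cong (λ x → suc (j + x)) (sym (toℕ-inject₁ c))))

  location-≤ : ∀ j (c : Fin ω) → j + toℕ c ∸ ω-1 ≤ j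
  location-≤ j c = ≤-trans (∸-monoˡ-≤ ω-1 (ℕ-+-monoʳ-≤ j (toℕ≤pred[n] c))) (≤-reflexive (m+n∸n≡m j ω-1))

  -- A column `x` lying fewer than ω columns left of `j` has window index ω-1-(j-x). The equation
  -- for `c` is kept in the result so that `c` can later be told apart from the last index.
  find-location : ∀ {j x} → x ≤ j → j ∸ x ≤ ω-1 →
                  ∃ λ (c : Fin ω) → toℕ c + (j ∸ x) ≡ ω-1 × (∀ r → location j r c ≡ x ∷ coords d-1 k r)
  find-location {j} {x} x≤j d≤ω = c , c+d , λ r → cong (_∷ coords d-1 k r) (begin
      j + toℕ c ∸ ω-1             ≡⟨ cong₂ (λ a b → a + toℕ c ∸ b) (sym (m+[n∸m]≡n x≤j)) (sym c+d) ⟩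
      x + d + toℕ c ∸ (toℕ c + d) ≡⟨ cong₂ _∸_ (+-assoc x d (toℕ c)) (+-comm (toℕ c) d) ⟩
      x + (d + toℕ c) ∸ (d + toℕ c) ≡⟨ m+n∸n≡m x (d + toℕ c) ⟩
      x ∎)
    where
    open ≡-Reasoning
    d = j ∸ x
    c = fromℕ< (s≤s (m∸n≤m ω-1 d))
    c+d : toℕ c + d ≡ ω-1
    c+d = trans (cong (_+ d) (toℕ-fromℕ< _)) (m∸n+n≡m d≤ω)

  -- Two occupied cells violating `same-row` or `same-column` would be joined by an edge. For rows
  -- the violation is the mere presence of two cells, because window columns are always closer than
  -- ω; hence that case derives a contradiction instead of a distance bound.
  independent⇒feasible : ∀ {S} → Independent S → ∀ j → FeasibleAt j (markWindow S j)
  independent⇒feasible {S} ind j = record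
    { zero-one    = markWindow-zeroOne S j
    ; same-row    = λ r c c′ c≢c′ W≢0 W′≢0 → ⊥-elim (row-conflict r c c′ c≢c′
                      (to (markWindow-≢0 S j r c) W≢0)
                      (to (markWindow-≢0 S j r c′) W′≢0))
    ; same-column = λ c r r′ W≢0 W′≢0 i differ → ≮⇒≥ (column-conflict c r r′ i differ
                      (to (markWindow-≢0 S j r c) W≢0)
                      (to (markWindow-≢0 S j r′ c) W′≢0))
    } , from (≤ₐ-window j (markWindow S j) (markWindow-zeroOne S j)) λ r c W≢0 →
          let v , _ , fv≡ = to (markWindow-≢0 S j r c) W≢0
          in  from (at-≢0 _) (v , fv≡)
    where
    row-conflict : ∀ r c c′ → c ≢ c′ → Occupied S (location j r c) → Occupied S (location j r c′) → ⊥
    row-conflict r c c′ c≢c′ (u , u∈S , fu≡) (v , v∈S , fv≡) =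
      ind u∈S v∈S (from (edge⇔ u v) ((zero , differ) , near))
      where
      x x′ : ℕ
      x  = j + toℕ c ∸ ω-1
      x′ = j + toℕ c′ ∸ ω-1
      -- An occupied cell has column at least 1, so the subtraction of ω-1 is not truncated and
      -- distances in the network equal distances of window indices.
      positive : ∀ v {c} → f v ≡ location j r c → ω-1 + (j + toℕ c ∸ ω-1) ≡ j + toℕ c
      positive v {c} fv≡ = m+[n∸m]≡n (<⇒≤ (m∸n≢0⇒n<m {j + toℕ c} {ω-1} λ ≡0 →
        <⇒≢ (proj₁ (column-within v)) (sym (trans (cong Vec.head fv≡) ≡0))))
      distance : ∣ x - x′ ∣ ≡ ∣ toℕ c - toℕ c′ ∣
      distance = begin
        ∣ x - x′ ∣                       ≡⟨ ∣m+n-m+o∣≡∣n-o∣ ω-1 x x′ ⟨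
        ∣ ω-1 + x - ω-1 + x′ ∣           ≡⟨ cong₂ ∣_-_∣ (positive u fu≡) (positive v fv≡) ⟩
        ∣ j + toℕ c - j + toℕ c′ ∣       ≡⟨ ∣m+n-m+o∣≡∣n-o∣ j _ _ ⟩
        ∣ toℕ c - toℕ c′ ∣               ∎
        where open ≡-Reasoning
      differ₀ : DifferOnlyAt zero (location j r c) (location j r c′)
      differ₀ = (λ x≡x′ → c≢c′ (toℕ-injective (∣m-n∣≡0⇒m≡n (trans (sym distance) (m≡n⇒∣m-n∣≡0 x≡x′)))))
              , λ { zero neq → contradiction refl neq ; (suc i) _ → refl }
      differ : DifferOnlyAt zero (f u) (f v)
      differ = subst₂ (DifferOnlyAt zero) (sym fu≡) (sym fv≡) differ₀
      near : manhattan (f u) (f v) < ω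
      near = subst (_< ω) (sym (trans (cong₂ manhattan fu≡ fv≡)
               (trans (manhattan-DifferOnlyAt zero _ _ differ₀) distance))) (∣toℕ-toℕ∣<n c c′)
    column-conflict : ∀ c r r′ i → DifferOnlyAt i (coords d-1 k r) (coords d-1 k r′) →
             Occupied S (location j r c) → Occupied S (location j r′ c) →
             ¬ ∣ lookup (coords d-1 k r) i - lookup (coords d-1 k r′) i ∣ < ω
    column-conflict c r r′ i (neq , eq) (u , u∈S , fu≡) (v , v∈S , fv≡) near =
      ind u∈S v∈S (from (edge⇔ u v)
        ( (suc i , subst₂ (DifferOnlyAt (suc i)) (sym fu≡) (sym fv≡) differ)
        , subst (_< ω) (sym (trans (cong₂ manhattan fu≡ fv≡) (manhattan-DifferOnlyAt (suc i) _ _ differ))) near))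
      where
      differ : DifferOnlyAt (suc i) (location j r c) (location j r′ c)
      differ = neq , λ { zero _ → refl ; (suc i′) i′≢ → eq i′ (i′≢ ∘ cong suc) }

  -- An edge from column `j` to a column at most `j` is seen in the window ending at `j`. If the
  -- endpoints differ in the column, they share a row and are closer than ω, against `same-row`;
  -- otherwise both lie in column `j`, against `same-column`.
  independent-at-end : ∀ {S j} → Feasible (markWindow S j) → ∀ {u v} → u ∈ S → v ∈ S →
                       column-of u ≤ j → column-of v ≡ j → ¬ Edge u v
  independent-at-end {S} {j} feas {u} {v} u∈S v∈S u≤j v≡j uv =
    let (i , differ) , near = to (edge⇔ u v) uv
    in  excluded i differ (subst (_< ω) (manhattan-DifferOnlyAt i (f u) (f v) differ) near)
    where
    open Feasible feas
    r = proj₁ (row-of u)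
    s = proj₁ (row-of v)
    fu≡ = proj₂ (row-of u)
    fv≡ : f v ≡ j ∷ coords d-1 k s
    fv≡ = trans (proj₂ (row-of v)) (cong (_∷ _) v≡j)
    last = fromℕ ω-1
    at-last : ∀ {x} t → x ∈ S → f x ≡ j ∷ coords d-1 k t → markWindow S j [ t , last ] ≢ 0#
    at-last {x} t x∈S fx≡ = from (markWindow-≢0 S j t last)
      (x , x∈S , trans fx≡ (sym (location-last j t)))
    excluded : ∀ i → DifferOnlyAt i (f u) (f v) → ∣ lookup (f u) i - lookup (f v) i ∣ < ω → ⊥
    excluded i differ rewrite fu≡ | fv≡ = excluded′ i differ
      where
      excluded′ : ∀ i → DifferOnlyAt i (column-of u ∷ coords d-1 k r) (j ∷ coords d-1 k s) →
                  ∣ lookup (column-of u ∷ coords d-1 k r) i - lookup (j ∷ coords d-1 k s) i ∣ < ω → ⊥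
      excluded′ zero (neq , eq) near = <⇒≱ (∣toℕ-toℕ∣<n c last)
        (same-row s c last c≢last
          (from (markWindow-≢0 S j s c)
            (u , u∈S , trans fu≡ (trans (cong (λ t → column-of u ∷ coords d-1 k t) r≡s) (sym (loc s)))))
          (at-last s v∈S fv≡))
        where
        r≡s : r ≡ s
        r≡s = coords-injective d-1 k (lookup-ext λ i → eq (suc i) (λ ()))
        found = find-location u≤j (s≤s⁻¹ (subst (_< ω) (m≤n⇒∣m-n∣≡n∸m u≤j) near))
        c = proj₁ found
        loc = proj₂ (proj₂ found)
        -- The index of `u` is ω-1 minus a positive distance, whereas `last` is ω-1.
        c≢last : c ≢ last
        c≢last c≡ = <⇒≢ (m<n⇒0<n∸m (≤∧≢⇒< u≤j neq)) (sym (+-cancelˡ-≡ (toℕ c) _ 0 (trans (proj₁ (proj₂ found))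
          (trans (sym (toℕ-fromℕ ω-1)) (trans (cong toℕ (sym c≡)) (sym (+-identityʳ _)))))))
      excluded′ (suc i) (neq , eq) near = <⇒≱ near
        (same-column last r s
          (at-last r u∈S (trans fu≡ (cong (_∷ _) (eq zero (λ ())))))
          (at-last s v∈S fv≡) i (neq , λ i′ i′≢i → eq (suc i′) (i′≢i ∘ suc-injective)))

  -- One step of the induction on columns: `S` lives in columns up to j+1 and `S′` is its part in
  -- columns up to `j`. It serves both for extending a solution by a column and for cutting a
  -- competitor down by one.
  record Restricts (j : ℕ) (S S′ : Subset order) : Set where
    field
      restricts : ∀ v → v ∈ S′ ⇔ (v ∈ S × column-of v ≤ j)
      bounded   : ∀ v → v ∈ S → column-of v ≤ suc j

    mark-restricts : ∀ {x} → x ≤ j → ∀ r → mark S (x ∷ coords d-1 k r) ≡ mark S′ (x ∷ coords d-1 k r)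
    mark-restricts {x} x≤j r = mark-cong (mk⇔
      (λ (v , v∈S , fv≡) → v , from (restricts v) (v∈S , subst (_≤ j) (sym (cong Vec.head fv≡)) x≤j) , fv≡)
      (λ (v , v∈S′ , fv≡) → v , proj₁ (to (restricts v) v∈S′) , fv≡))

    window-restricts : markWindow S′ j ⊨ markWindow S (suc j)
    window-restricts = from (⊨-entries (markWindow S′ j) (markWindow S (suc j))) λ r c → begin
      markWindow S′ j [ r , suc c ]              ≡⟨ markWindow-entry S′ j r (suc c) ⟩
      mark S′ (location j r (suc c))             ≡⟨ mark-restricts (location-≤ j (suc c)) r ⟨
      mark S (location j r (suc c))              ≡⟨ cong (mark S) (location-suc j r c) ⟩
      mark S (location (suc j) r (inject₁ c))    ≡⟨ markWindow-entry S (suc j) r (inject₁ c) ⟨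
      markWindow S (suc j) [ r , inject₁ c ]     ∎
      where open ≡-Reasoning

  private
    contribution : Subset order → Fin order → Carrier
    contribution S v = if lookup S v then w v else 0#

    contribution-∈ : ∀ {S v} → v ∈ S → contribution S v ≡ w v
    contribution-∈ v∈S rewrite []=⇒lookup v∈S = refl

    contribution-∉ : ∀ {S v} → ¬ v ∈ S → contribution S v ≡ 0#
    contribution-∉ {S} {v} v∉S with lookup S v in eq
    ... | true  = contradiction (lookup⇒[]= v S eq) v∉S
    ... | false = refl

    at? : ∀ v p → Dec (f v ≡ p)
    at? v p = ≡-dec _≟_ (f v) p

    -- At most one vertex sits at `p`, since the embedding is injective. Writing the product as a
    -- sum over vertices prepares the exchange of sums in `⟨last-markWindow,column⟩`.
    mark*at : ∀ S p → mark S p *ⁿ at p ≡ sum (λ v → at? v p · contribution S v)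
    mark*at S p = by-cases (any? (λ v → at? v p))
      where
      at-vertex-case : ∀ v → mark S (f v) *ⁿ at (f v) ≡ contribution S v
      at-vertex-case v with occupied? S (f v)
      ... | yes (u , u∈S , fu≡fv) = trans (CR.*-identityˡ _) (trans (at-vertex v)
              (sym (contribution-∈ (subst (_∈ S) (f-injective fu≡fv) u∈S))))
      ... | no none = trans (CR.zeroˡ _) (sym (contribution-∉ λ v∈S → none (v , v∈S , refl)))
      by-cases : Dec (∃ λ v → f v ≡ p) → mark S p *ⁿ at p ≡ sum (λ v → at? v p · contribution S v)
      by-cases (no none) = trans (cong (mark S p *ⁿ_) (at-empty p (λ v fv≡p → none (v , fv≡p))))
        (trans (CR.zeroʳ _) (sym (sum-zero _ λ v → ·-no (at? v p) _ (λ fv≡p → none (v , fv≡p)))))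
      by-cases (yes (v , refl)) = trans (at-vertex-case v) (sym (trans
        (sum-single _ v (λ u u≢v → ·-no (at? u _) _ (u≢v ∘ f-injective)))
        (·-yes (at? v _) _ refl)))

    -- A vertex in column `x` occupies exactly one row, so only one summand survives.
    sum-column : ∀ S x v → sum (λ r → at? v (x ∷ coords d-1 k r) · contribution S v) ≡
                 (column-of v ≟ x) · contribution S v
    sum-column S x v = by-cases (column-of v ≟ x)
      where
      by-cases : Dec (column-of v ≡ x) → sum (λ r → at? v (x ∷ coords d-1 k r) · contribution S v) ≡
                 (column-of v ≟ x) · contribution S v
      by-cases (yes refl) = let r , fv≡ = row-of v in
        trans (sum-single _ r (λ r′ r′≢r → ·-no (at? v _) _ λ fv≡′ →
                 r′≢r (coords-injective d-1 k (cong Vec.tail (trans (sym fv≡′) fv≡)))))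
              (trans (·-yes (at? v _) _ fv≡) (sym (·-yes (column-of v ≟ column-of v) _ refl)))
      by-cases (no ≢x) = trans (sum-zero _ λ r → ·-no (at? v (x ∷ coords d-1 k r)) (contribution S v) (≢x ∘ cong Vec.head))
        (sym (·-no (column-of v ≟ x) _ ≢x))

  -- The Frobenius product is the weight of `S` in column `j`: expand each row as a sum over
  -- vertices, then sum over rows first.
  ⟨last-markWindow,column⟩ : ∀ S j → ⟨ Vec.last (markWindow S j) , column j ⟩ ≡
                             sum (λ v → (column-of v ≟ j) · contribution S v)
  ⟨last-markWindow,column⟩ S j = begin
    ⟨ Vec.last (markWindow S j) , column j ⟩
      ≡⟨ sum-cong-≗ (λ r → cong₂ _*ⁿ_ (last-entry r) (column-entry r)) ⟩
    sum (λ r → mark S (j ∷ coords d-1 k r) *ⁿ at (j ∷ coords d-1 k r))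
      ≡⟨ sum-cong-≗ (λ r → mark*at S (j ∷ coords d-1 k r)) ⟩
    sum (λ r → sum (λ v → at? v (j ∷ coords d-1 k r) · contribution S v))
      ≡⟨ ∑-comm (λ r v → at? v (j ∷ coords d-1 k r) · contribution S v) ⟩
    sum (λ v → sum (λ r → at? v (j ∷ coords d-1 k r) · contribution S v))
      ≡⟨ sum-cong-≗ (sum-column S j) ⟩
    sum (λ v → (column-of v ≟ j) · contribution S v) ∎
    where
    open ≡-Reasoning
    last-entry : ∀ r → lookup (Vec.last (markWindow S j)) r ≡ mark S (j ∷ coords d-1 k r)
    last-entry r = trans (cong (λ X → lookup X r) (last-lookup (markWindow S j)))
      (trans (markWindow-entry S j r (fromℕ ω-1)) (cong (mark S) (location-last j r)))
    column-entry : ∀ r → lookup (column j) r ≡ at (j ∷ coords d-1 k r)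
    column-entry r = trans (lookup∘tabulate _ r) (cong (λ x → at (x ∷ coords d-1 k r)) (m+n∸n≡m j ω-1))

  -- The counterpart of `MIS-step` for weights: each vertex of `S` is counted either in column j+1
  -- or in `S′`, never in both.
  weight-restricts : ∀ {j S S′} → Restricts j S S′ →
    weight S ≡ ⟨ Vec.last (markWindow S (suc j)) , column (suc j) ⟩ +ⁿ weight S′
  weight-restricts {j} {S} {S′} res = begin
    sum (contribution S)
      ≡⟨ sum-cong-≗ split ⟩
    sum (λ v → ((column-of v ≟ suc j) · contribution S v) +ⁿ contribution S′ v)
      ≡⟨ ∑-distrib-+ _ (contribution S′) ⟩
    sum (λ v → (column-of v ≟ suc j) · contribution S v) +ⁿ weight S′
      ≡⟨ cong (_+ⁿ weight S′) (⟨last-markWindow,column⟩ S (suc j)) ⟨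
    ⟨ Vec.last (markWindow S (suc j)) , column (suc j) ⟩ +ⁿ weight S′ ∎
    where
    open ≡-Reasoning
    open Restricts res
    split : ∀ v → contribution S v ≡
            ((column-of v ≟ suc j) · contribution S v) +ⁿ contribution S′ v
    split v = by-cases (column-of v ≟ suc j) (v ∈? S)
      where
      by-cases : Dec (column-of v ≡ suc j) → Dec (v ∈ S) →
                 contribution S v ≡ ((column-of v ≟ suc j) · contribution S v) +ⁿ contribution S′ v
      by-cases (yes ≡j) _ = sym (trans (cong₂ _+ⁿ_ (·-yes (column-of v ≟ suc j) _ ≡j)
        (contribution-∉ λ v∈S′ → <⇒≱ (≤-reflexive (sym ≡j)) (proj₂ (to (restricts v) v∈S′))))
        (CR.+-identityʳ _))
      by-cases (no ≢j) v∈?S = sym (trans (cong₂ _+ⁿ_ (·-no (column-of v ≟ suc j) _ ≢j) (same v∈?S))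
        (CR.+-identityˡ _))
        where
        same : Dec (v ∈ S) → contribution S′ v ≡ contribution S v
        same (yes v∈S) = trans (contribution-∈ (from (restricts v)
          (v∈S , m<1+n⇒m≤n (≤∧≢⇒< (bounded v v∈S) ≢j)))) (sym (contribution-∈ v∈S))
        same (no v∉S) = trans (contribution-∉ (v∉S ∘ proj₁ ∘ to (restricts v))) (sym (contribution-∉ v∉S))

-- Correctness of every run

module RunProperties {R : OrderedRing} {d-1 k n-1 ω-1 : ℕ}
  (G : LoSNetwork R d-1 k (suc n-1) (suc ω-1)) (ρ : Run G) where
  open OrderedRing R
  open OrderedRingProperties R
  open LoSNetwork G
  open Arrays R d-1 k
  open NetworkArray G
  open NetworkProperties G
  open Run ρ

  private
    n = suc n-1

  -- All locations of the window ending at 0 have column 0, where no vertex lies. So `MIS-start`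
  -- covers every array admissible at column 0.
  feasible-at-0 : ∀ W → FeasibleAt 0 W → W ≡ zeros ω
  feasible-at-0 W (feas , W≤) = lookup-ext λ c → lookup-ext λ r →
    trans (entry r c) (sym (trans (cong (λ X → lookup X r) (lookup-replicate c _)) (lookup-replicate r 0#)))
    where
    entry : ∀ r c → W [ r , c ] ≡ 0#
    entry r c with Feasible.zero-one feas r c
    ... | inj₁ ≡0 = ≡0
    ... | inj₂ ≡1 =
      let v , fv≡ = to (at-≢0 _) (to (≤ₐ-window 0 W (Feasible.zero-one feas)) W≤ r c
                      (λ ≡0 → 0≢1 (trans (sym ≡0) ≡1)))
      in  contradiction (trans (cong Vec.head fv≡) (m≤n⇒m∸n≡0 (toℕ≤pred[n] c)))
            (<⇒≢ (proj₁ (column-within v)) ∘ sym)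

  -- `retrieve j` delivers columns 1 to j+1, so the condition for column j+1 speaks of `retrieve j`,
  -- and at column 0 there is nothing to retrieve.
  Retrieved : ℕ → Array ω → Subset order → Set
  Retrieved zero    W S = ⊤
  Retrieved (suc j) W S = ∀ r x → retrieve j W [ r , x ] ≡ mark S (suc (toℕ x) ∷ coords d-1 k r)

  -- The set that witnesses `MIS j W` also has to be the one that retrieval marks. Both follow the
  -- same chain of `pred`, so they are built in one induction.
  record Solution (j : ℕ) (W : Array ω) : Set where
    field
      set         : Subset order
      independent : Independent set
      bounded     : ∀ v → v ∈ set → column-of v ≤ j
      window≡     : W ≡ markWindow set j
      value       : MIS j W ≡ weight set
      retrieved   : Retrieved j W set

  -- The solution for the predecessor is enlarged by the vertices of column j+1 that the last column
  -- of `W` marks.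
  module Extend (j : ℕ) (j<n : j < n) (W : Array ω) (feasW : FeasibleAt (suc j) W)
                (sol : Solution j (pred (suc j) W)) where
    open Solution sol renaming (set to S*)

    last : Fin ω
    last = fromℕ ω-1

    New : Fin order → Set
    New v = ∃ λ r → W [ r , last ] ≢ 0# × f v ≡ suc j ∷ coords d-1 k r

    member? : ∀ v → Dec (v ∈ S* ⊎ New v)
    member? v = (v ∈? S*) ⊎-dec any? (λ r → ¬? (W [ r , last ] ≟ⁿ 0#) ×-dec ≡-dec _≟_ (f v) (suc j ∷ coords d-1 k r))

    S : Subset order
    S = fromDec member?

    ∈S⇒ : ∀ {v} → v ∈ S → v ∈ S* ⊎ New v
    ∈S⇒ = to (∈-fromDec member?)

    ⇒∈S : ∀ {v} → v ∈ S* ⊎ New v → v ∈ S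
    ⇒∈S = from (∈-fromDec member?)

    bounded-S : ∀ v → v ∈ S → column-of v ≤ suc j
    bounded-S v v∈S with ∈S⇒ v∈S
    ... | inj₁ v∈S*          = m≤n⇒m≤1+n (bounded v v∈S*)
    ... | inj₂ (_ , _ , fv≡) = ≤-reflexive (cong Vec.head fv≡)

    old : ∀ {v} → v ∈ S → column-of v ≤ j → v ∈ S*
    old v∈S v≤j with ∈S⇒ v∈S
    ... | inj₁ v∈S*          = v∈S*
    ... | inj₂ (_ , _ , fv≡) = contradiction (subst (_≤ j) (cong Vec.head fv≡) v≤j) 1+n≰n

    restr : Restricts j S S*
    restr = record
      { restricts = λ v → mk⇔ (λ v∈S* → ⇒∈S (inj₁ v∈S*) , bounded v v∈S*) (λ (v∈S , v≤j) → old v∈S v≤j)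
      ; bounded   = bounded-S
      }
    open Restricts restr using (window-restricts; mark-restricts)

    last-entry : ∀ r → W [ r , last ] ≡ mark S (suc j ∷ coords d-1 k r)
    last-entry r = isBit-ext (Feasible.zero-one (proj₁ feasW) r last) (mark-isBit S _) (mk⇔
      (λ W≢0 → from (mark-≢0 S _)
        (let v , fv≡ = to (at-≢0 _) (to (≤ₐ-window (suc j) W (Feasible.zero-one (proj₁ feasW)))
                         (proj₂ feasW) r last W≢0)
             fv≡′ = trans fv≡ (location-last (suc j) r)
         in  v , ⇒∈S (inj₂ (r , W≢0 , fv≡′)) , fv≡′))
      (λ mark≢0 → marked (to (mark-≢0 S _) mark≢0)))
      where
      marked : Occupied S (suc j ∷ coords d-1 k r) → W [ r , last ] ≢ 0#
      marked (v , v∈S , fv≡) with ∈S⇒ v∈S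
      ... | inj₁ v∈S* = contradiction (subst (_≤ j) (cong Vec.head fv≡) (bounded v v∈S*)) 1+n≰n
      ... | inj₂ (r′ , W≢0 , fv≡′) = subst (λ r → W [ r , last ] ≢ 0#)
              (coords-injective d-1 k (cong Vec.tail (trans (sym fv≡′) fv≡))) W≢0

    -- The last column agrees by the choice of the new vertices, the others because `W` is
    -- consistent with its predecessor, whose window is known by induction.
    window-S : W ≡ markWindow S (suc j)
    window-S = lookup-ext λ c → lookup-ext λ r → entry r c
      where
      open ≡-Reasoning
      entry : ∀ r c → W [ r , c ] ≡ markWindow S (suc j) [ r , c ]
      entry r c with view c
      ... | ‵fromℕ = begin
        W [ r , last ]                         ≡⟨ last-entry r ⟩
        mark S (suc j ∷ coords d-1 k r)        ≡⟨ cong (mark S) (location-last (suc j) r) ⟨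
        mark S (location (suc j) r last)       ≡⟨ markWindow-entry S (suc j) r last ⟨
        markWindow S (suc j) [ r , last ]      ∎
      ... | ‵inject₁ c = begin
        W [ r , inject₁ c ]                    ≡⟨ to (⊨-entries (pred (suc j) W) W) (pred-consistent j W j<n feasW) r c ⟨
        pred (suc j) W [ r , suc c ]           ≡⟨ cong (_[ r , suc c ]) window≡ ⟩
        markWindow S* j [ r , suc c ]          ≡⟨ to (⊨-entries (markWindow S* j) (markWindow S (suc j))) window-restricts r c ⟩
        markWindow S (suc j) [ r , inject₁ c ] ∎

    -- Edges inside columns up to `j` are excluded by induction. Any other edge has an end in column
    -- j+1, to which `independent-at-end` applies, after `symm` if that end is `u`.
    independent-S : Independent S
    independent-S {u} {v} u∈S v∈S uv with column-of u ≤? j | column-of v ≤? j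
    ... | yes u≤j | yes v≤j = independent (old u∈S u≤j) (old v∈S v≤j) uv
    ... | _       | no  v≰j = independent-at-end (subst Feasible window-S (proj₁ feasW)) u∈S v∈S
            (bounded-S u u∈S) (≤-antisym (bounded-S v v∈S) (≰⇒> v≰j)) uv
    ... | no  u≰j | _       = independent-at-end (subst Feasible window-S (proj₁ feasW)) v∈S u∈S
            (bounded-S v v∈S) (≤-antisym (bounded-S u u∈S) (≰⇒> u≰j)) (symm uv)

    value-S : MIS (suc j) W ≡ weight S
    value-S = begin
      MIS (suc j) W                                                    ≡⟨ MIS-step j W j<n feasW ⟩
      ⟨ Vec.last W , column (suc j) ⟩ +ⁿ MIS j (pred (suc j) W)        ≡⟨ cong₂ (λ X m → ⟨ Vec.last X , column (suc j) ⟩ +ⁿ m) window-S value ⟩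
      ⟨ Vec.last (markWindow S (suc j)) , column (suc j) ⟩ +ⁿ weight S* ≡⟨ weight-restricts restr ⟨
      weight S                                                         ∎
      where open ≡-Reasoning

    last-column : ∀ r → lookup (Vec.last W) r ≡ mark S (suc j ∷ coords d-1 k r)
    last-column r = trans (cong (λ X → lookup X r) (last-lookup W)) (last-entry r)

    retrieved-S : Retrieved (suc j) W S
    retrieved-S = go j refl retrieved
      where
      -- The set `S` is built for the fixed `j`; splitting on a copy `i` lets `retrieve` and
      -- `Retrieved` unfold.
      go : ∀ i → i ≡ j → Retrieved i (pred (suc i) W) S* → ∀ r x → retrieve i W [ r , x ] ≡ mark S (suc (toℕ x) ∷ coords d-1 k r)
      go zero    refl _  r zero = last-column r
      go (suc i) refl IH r x with view x
      ... | ‵fromℕ = begin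
        lookup (lookup (retrieve i (pred (suc j) W) ∷ʳ Vec.last W) (fromℕ (suc i))) r
          ≡⟨ cong (λ X → lookup X r) (lookup-∷ʳ-last (retrieve i (pred (suc j) W)) (Vec.last W)) ⟩
        lookup (Vec.last W) r
          ≡⟨ last-column r ⟩
        mark S (suc (suc i) ∷ coords d-1 k r)
          ≡⟨ cong (λ x → mark S (suc x ∷ coords d-1 k r)) (toℕ-fromℕ (suc i)) ⟨
        mark S (suc (toℕ (fromℕ (suc i))) ∷ coords d-1 k r) ∎
        where open ≡-Reasoning
      ... | ‵inject₁ x = begin
        lookup (lookup (retrieve i (pred (suc j) W) ∷ʳ Vec.last W) (inject₁ x)) r
          ≡⟨ cong (λ X → lookup X r) (lookup-∷ʳ-inject₁ (retrieve i (pred (suc j) W)) (Vec.last W) x) ⟩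
        retrieve i (pred (suc j) W) [ r , x ]
          ≡⟨ IH r x ⟩
        mark S* (suc (toℕ x) ∷ coords d-1 k r)
          ≡⟨ mark-restricts (toℕ<n x) r ⟨
        mark S (suc (toℕ x) ∷ coords d-1 k r)
          ≡⟨ cong (λ x → mark S (suc x ∷ coords d-1 k r)) (toℕ-inject₁ x) ⟨
        mark S (suc (toℕ (inject₁ x)) ∷ coords d-1 k r) ∎
        where open ≡-Reasoning

    extended : Solution (suc j) W
    extended = record
      { set = S ; independent = independent-S ; bounded = bounded-S
      ; window≡ = window-S ; value = value-S ; retrieved = retrieved-S }

  solution : ∀ j W → j ≤ n → FeasibleAt j W → Solution j W
  solution zero W _ feasW = record
    { set         = ∅
    ; independent = λ u∈∅ → contradiction u∈∅ ∉⊥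
    ; bounded     = λ v v∈∅ → contradiction v∈∅ ∉⊥
    ; window≡     = trans (feasible-at-0 W feasW) (sym (feasible-at-0 (markWindow ∅ 0)
                      (independent⇒feasible {∅} (λ u∈∅ → contradiction u∈∅ ∉⊥) 0)))
    ; value       = trans (cong (MIS 0) (feasible-at-0 W feasW)) (trans MIS-start (sym (sum-zero _ λ v →
                      cong (λ b → if b then w v else 0#) (lookup-replicate v false))))
    ; retrieved   = tt
    }
  solution (suc j) W j<n feasW = Extend.extended j j<n W feasW
    (solution j (pred (suc j) W) (<⇒≤ j<n) (pred-feasible j W j<n feasW))

  weight≤MIS : ∀ j T → j ≤ n → Independent T → (∀ v → v ∈ T → column-of v ≤ j) →
               weight T ≤ⁿ MIS j (markWindow T j)
  weight≤MIS zero T _ ind bounded = ≤ⁿ-reflexive (begin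
    weight T               ≡⟨ sum-zero _ empty ⟩
    0#                     ≡⟨ MIS-start ⟨
    MIS 0 (zeros ω)        ≡⟨ cong (MIS 0) (feasible-at-0 (markWindow T 0) (independent⇒feasible ind 0)) ⟨
    MIS 0 (markWindow T 0) ∎)
    where
    open ≡-Reasoning
    empty : ∀ v → (if lookup T v then w v else 0#) ≡ 0#
    empty v with lookup T v in eq
    ... | false = refl
    ... | true  = contradiction (≤-trans (proj₁ (column-within v)) (bounded v (lookup⇒[]= v T eq))) 1+n≰n
  weight≤MIS (suc j) T j<n ind bounded =
    subst₂ _≤ⁿ_ (sym (weight-restricts restr)) (sym (MIS-step j W j<n feasW))
      -- Both sides gain the same product in column j+1, so it remains to compare the trace of `T′`
      -- with the predecessor actually chosen.
      (+-monoʳ-≤ _ (≤ⁿ-trans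
        (weight≤MIS j T′ (<⇒≤ j<n) ind′ (λ v → proj₂ ∘ to (∈-fromDec kept?)))
        (pred-maximal j W j<n feasW (markWindow T′ j) (independent⇒feasible ind′ j)
          (Restricts.window-restricts restr))))
    where
    W = markWindow T (suc j)
    feasW = independent⇒feasible ind (suc j)
    kept? : ∀ v → Dec (v ∈ T × column-of v ≤ j)
    kept? v = (v ∈? T) ×-dec (column-of v ≤? j)
    T′ = fromDec kept?
    ind′ : Independent T′
    ind′ u∈T′ v∈T′ = ind (proj₁ (to (∈-fromDec kept?) u∈T′)) (proj₁ (to (∈-fromDec kept?) v∈T′))
    restr : Restricts j T T′
    restr = record { restricts = λ v → ∈-fromDec kept? ; bounded = bounded }

  output-correct : MarksMaximumIndependentSet output
  output-correct = set , marks , independent , λ T ind → ≤ⁿ-trans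
      (weight≤MIS n T ≤-refl ind (λ v _ → proj₂ (column-within v)))
      (subst (MIS n (markWindow T n) ≤ⁿ_) value (final-maximal (markWindow T n) (independent⇒feasible ind n)))
    where
    open Solution (solution n final ≤-refl final-feasible)
    marks : Marks output set
    marks r x = subst (λ a → a ≢ 0# ⇔ Occupied set (suc (toℕ x) ∷ coords d-1 k r)) (sym (retrieved r x)) (mark-≢0 set _)

-- Values of programs

module SemanticsProperties (R : OrderedRing) where
  open OrderedRing R
  open OrderedRingProperties R
  open Semantics R

  ≤ᵇ-true : ∀ {a b} → (a ≤ᵇ b) ≡ true ⇔ a ≤ b
  ≤ᵇ-true {a} {b} = mk⇔ (≤ᵇ⇒≤ a b ∘ from T-≡) (to T-≡ ∘ ≤⇒≤ᵇ)

  +1≤ᵇ-true : ∀ {a b} → (a + 1 ≤ᵇ b) ≡ true ⇔ a < b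
  +1≤ᵇ-true {a} {b} = subst (λ x → (x ≤ᵇ b) ≡ true ⇔ a < b) (+-comm 1 a) ≤ᵇ-true

  if-true : ∀ {A : Set} {b} {x y : A} → b ≡ true → (if b then x else y) ≡ x
  if-true refl = refl

  if-false : ∀ {A : Set} {b} {x y : A} → b ≢ true → (if b then x else y) ≡ y
  if-false {b = false} _ = refl
  if-false {b = true}  ≢true = contradiction refl ≢true

  if-elim : ∀ {A : Set} (I : A → Set) b {x y : A} → (b ≡ true → I x) → (b ≢ true → I y) → I (if b then x else y)
  if-elim I true  Ix Iy = Ix refl
  if-elim I false Ix Iy = Iy (λ ())

  ≤ⁿ?-true : ∀ {a b} → ⌊ a ≤ⁿ? b ⌋ ≡ true → a ≤ⁿ b
  ≤ⁿ?-true {a} {b} eq with a ≤ⁿ? b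
  ... | yes a≤b = a≤b

  ≤ⁿ?-false : ∀ {a b} → ⌊ a ≤ⁿ? b ⌋ ≢ true → b ≤ⁿ a
  ≤ⁿ?-false {a} {b} ≢true with a ≤ⁿ? b | ≤ⁿ-total a b
  ... | yes _   | _        = contradiction refl ≢true
  ... | no  a≰b | inj₁ a≤b = contradiction a≤b a≰b
  ... | no  _   | inj₂ b≤a = b≤a

  or-true : ∀ e e′ → value (e or e′) ≡ true ⇔ (value e ≡ true ⊎ value e′ ≡ true)
  or-true e e′ with value e
  ... | true  = mk⇔ (λ _ → inj₁ refl) (λ _ → refl)
  ... | false = mk⇔ inj₂ [ (λ ()) , (λ eq → eq) ]′

  and-true : ∀ e e′ → value (e and e′) ≡ true ⇔ (value e ≡ true × value e′ ≡ true)
  and-true e e′ with value e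
  ... | true  = mk⇔ (refl ,_) proj₂
  ... | false = mk⇔ (λ ()) proj₁

  every-true : ∀ {m} (es : Fin m → Exp ⟦_⟧ bool) → value (every es) ≡ true ⇔ (∀ r → value (es r) ≡ true)
  every-true {zero}  es = mk⇔ (λ _ ()) (λ _ → refl)
  every-true {suc m} es = mk⇔
    (λ eq → λ { zero    → proj₁ (to (and-true (es zero) (every (es ∘ suc))) eq)
              ; (suc r) → to (every-true (es ∘ suc)) (proj₂ (to (and-true (es zero) (every (es ∘ suc))) eq)) r })
    (λ eq → from (and-true (es zero) (every (es ∘ suc))) (eq zero , from (every-true (es ∘ suc)) (eq ∘ suc)))

  total-sum : ∀ {m} (es : Fin m → Exp ⟦_⟧ num) → value (total es) ≡ sum (λ r → value (es r))
  total-sum {zero}  es = refl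
  total-sum {suc m} es = cong (value (es zero) +ⁿ_) (total-sum (es ∘ suc))

  -- The program can only test `e ≤ 0`; for a non-negative value this is equality with 0.
  nonzero-true : ∀ e → 0# ≤ⁿ value e → value (nonzero e) ≡ true ⇔ value e ≢ 0#
  nonzero-true e 0≤e with value e ≤ⁿ? 0#
  ... | yes e≤0 = mk⇔ (λ ()) (λ ≢0 → contradiction (≤ⁿ-antisym e≤0 0≤e) ≢0)
  ... | no  e≰0 = mk⇔ (λ _ ≡0 → e≰0 (≤ⁿ-reflexive ≡0)) (λ _ → refl)

  nth-applyUpTo : ∀ τ g {m i} → i < m → nth τ (List.applyUpTo g m) i ≡ g i
  nth-applyUpTo τ g {suc m} {zero}  _         = refl
  nth-applyUpTo τ g {suc m} {suc i} (s≤s i<m) = nth-applyUpTo τ (g ∘ suc) i<m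

  select-cong : ∀ {τ m} (t t′ : Exp ⟦_⟧ (Table m τ)) (is : Vec (Exp ⟦_⟧ word) m) →
                value t ≡ value t′ → value (select {τ = τ} t is) ≡ value (select {τ = τ} t′ is)
  select-cong t t′ []       eq = eq
  select-cong {τ} {suc m} t t′ (i ∷ is) eq =
    select-cong (t ! i) (t′ ! i) is (cong (λ xs → nth (Table m τ) xs (value i)) eq)

  -- `select` recurses on the expression `t ! i`, which is no longer a `fillAll`; hence `t` is any
  -- expression that has the value of one.
  select-fillAll : ∀ {τ} m b (e : Vec ℕ m → Exp ⟦_⟧ τ) t is → value t ≡ value (fillAll m b e) →
                   (∀ i → value (lookup is i) < value b) → value (select t is) ≡ value (e (Vec.map value is))
  select-fillAll zero    b e t []       eq is<b = eq
  select-fillAll {τ} (suc m) b e t (i ∷ is) eq is<b =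
    select-fillAll m b (λ js → e (value i ∷ js)) (t ! i) is
      (trans (cong (λ xs → nth (Table m τ) xs (value i)) eq)
             (nth-applyUpTo (Table m τ) (λ i → value (fillAll m b (λ js → e (i ∷ js)))) (is<b zero)))
      (is<b ∘ suc)

  iterate-const : ∀ {A : Set} m (z : A) (s : A → A) →
                  iterate (suc m) z (λ _ → s) ≡ iterate m (s z) (λ _ → s)
  iterate-const zero    z s = refl
  iterate-const (suc m) z s = cong s (iterate-const m z s)

  iterate-invariant : ∀ {A : Set} (I : A → Set) m {z s} → I z → (∀ {i a} → i < m → I a → I (s i a)) →
                      I (iterate m z s)
  iterate-invariant I zero    Iz Is = Iz
  iterate-invariant I (suc m) Iz Is = Is ≤-refl (iterate-invariant I m Iz (Is ∘ m≤n⇒m≤1+n))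

  -- Meant for running maxima: iteration `j` meets its candidate and establishes the lower bound,
  -- and all later iterations keep it.
  iterate-reaches : ∀ {A : Set} (I : A → Set) m {z s j} → j < m → (∀ a → I (s j a)) →
                    (∀ i {a} → I a → I (s i a)) → I (iterate m z s)
  iterate-reaches I (suc m) {j = j} j<m Ij Is with j ≟ m
  ... | yes refl = Ij _
  ... | no  j≢m  = Is m (iterate-reaches I m (≤∧≢⇒< (s≤s⁻¹ j<m) j≢m) Ij Is)

  Below : ∀ {m} → ℕ → Vec ℕ m → Set
  Below b is = ∀ i → lookup is i < b

  loopAll-invariant : ∀ {σ} (I : ⟦ σ ⟧ → Set) m b z (e : Vec ℕ m → ⟦ σ ⟧ → Exp ⟦_⟧ σ) → I (value z) →
                      (∀ is {s} → Below (value b) is → I s → I (value (e is s))) →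
                      I (value (loopAll m b z e))
  loopAll-invariant I zero    b z e Iz Ie = Ie [] (λ ()) Iz
  loopAll-invariant I (suc m) b z e Iz Ie = iterate-invariant I (value b) Iz λ {i} {s} i<b Is →
    loopAll-invariant I m b (var s) (λ is → e (i ∷ is)) Is λ is is<b →
      Ie (i ∷ is) λ { zero → i<b ; (suc j) → is<b j }

  loopAll-reaches : ∀ {σ} (I : ⟦ σ ⟧ → Set) m b z (e : Vec ℕ m → ⟦ σ ⟧ → Exp ⟦_⟧ σ) is →
                    Below (value b) is → (∀ s → I (value (e is s))) → (∀ is {s} → I s → I (value (e is s))) →
                    I (value (loopAll m b z e))
  loopAll-reaches I zero    b z e []       is<b Iis Ie = Iis _
  loopAll-reaches I (suc m) b z e (i ∷ is) is<b Iis Ie = iterate-reaches I (value b) (is<b zero)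
    (λ s → loopAll-reaches I m b (var s) (λ js → e (i ∷ js)) is (is<b ∘ suc) Iis (λ js → Ie (i ∷ js)))
    (λ j {s} Is → loopAll-invariant I m b (var s) (λ js → e (j ∷ js)) Is (λ js _ → Ie (j ∷ js)))

-- The run computed by the program

module Implementation {R : OrderedRing} {d-1 k n-1 ω-1 : ℕ}
  (G : LoSNetwork R d-1 k (suc n-1) (suc ω-1)) where
  open OrderedRing R
  open OrderedRingProperties R
  open Semantics R
  open SemanticsProperties R
  open Arrays R d-1 k
  open NetworkArray G
  open NetworkProperties G
  open Execution G
  open import Algebra.Properties.CommutativeMonoid.Sum +-commutativeMonoid using (sum-cong-≗)

  n : ℕ
  n = suc n-1

  module P = Program d-1 k {⟦_⟧} n ω input

  -- Codes and the feasible arrays they represent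

  Code : Set
  Code = Vec ℕ K

  Bounded : Code → Set
  Bounded C = ∀ r → lookup C r ≤ ω

  decode : Code → Array ω
  -- Columns are counted from 1 in codes, so the code 0 matches no column and gives a zero row.
  decode C = tabulate λ c → tabulate λ r → bit (does (lookup C r ≟ suc (toℕ c)))

  decode-entry : ∀ C r c → decode C [ r , c ] ≡ bit (does (lookup C r ≟ suc (toℕ c)))
  decode-entry C r c = lookup²∘tabulate² (λ c r → bit (does (lookup C r ≟ suc (toℕ c)))) c r

  decode-≢0 : ∀ C r c → decode C [ r , c ] ≢ 0# ⇔ lookup C r ≡ suc (toℕ c)
  decode-≢0 C r c = subst (λ x → x ≢ 0# ⇔ lookup C r ≡ suc (toℕ c)) (sym (decode-entry C r c)) (bit-does (lookup C r ≟ suc (toℕ c)))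

  decode-zeroOne : ∀ C → ZeroOne (decode C)
  decode-zeroOne C r c = subst IsBit (sym (decode-entry C r c)) (bit-isBit _)

  position : ∀ {W : Array ω} {r} → Dec (∃ λ c → W [ r , c ] ≢ 0#) → ℕ
  position (yes (c , _)) = suc (toℕ c)
  position (no  _)       = 0

  position? : ∀ (W : Array ω) r → Dec (∃ λ c → W [ r , c ] ≢ 0#)
  position? W r = any? (λ c → ¬? (W [ r , c ] ≟ⁿ 0#))

  encode : Array ω → Code
  encode W = tabulate λ r → position {W} {r} (position? W r)

  encode-entry : ∀ W r → lookup (encode W) r ≡ position {W} {r} (position? W r)
  encode-entry W r = lookup∘tabulate _ r

  encode-bounded : ∀ W → Bounded (encode W)
  encode-bounded W r = subst (_≤ ω) (sym (encode-entry W r)) (bound (position? W r))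
    where
    bound : ∀ p → position {W} {r} p ≤ ω
    bound (yes (c , _)) = toℕ<n c
    bound (no _)        = z≤n

  -- `any?` finds some non-zero column of the row. It is the only one, since two would be at
  -- distance at least ω by `same-row`, yet window indices differ by less than ω.
  encode-≢0 : ∀ {W} → Feasible W → ∀ r c → W [ r , c ] ≢ 0# ⇔ lookup (encode W) r ≡ suc (toℕ c)
  encode-≢0 {W} feas r c = subst (λ x → W [ r , c ] ≢ 0# ⇔ x ≡ suc (toℕ c)) (sym (encode-entry W r)) (spec (position? W r))
    where
    spec : ∀ p → W [ r , c ] ≢ 0# ⇔ position {W} {r} p ≡ suc (toℕ c)
    spec (yes (c′ , W′≢0)) = mk⇔ (λ W≢0 → cong (suc ∘ toℕ) (unique (c′ ≟ᶠ c) W≢0))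
      (λ eq → subst (λ c → W [ r , c ] ≢ 0#) (toℕ-injective (ℕ-suc-injective eq)) W′≢0)
      where
      unique : Dec (c′ ≡ c) → W [ r , c ] ≢ 0# → c′ ≡ c
      unique (yes eq) _   = eq
      unique (no neq) W≢0 = contradiction (Feasible.same-row feas r c′ c neq W′≢0 W≢0) (<⇒≱ (∣toℕ-toℕ∣<n c′ c))
    spec (no none) = mk⇔ (λ W≢0 → contradiction (c , W≢0) none) (λ ())

  decode∘encode : ∀ {W} → Feasible W → decode (encode W) ≡ W
  decode∘encode {W} feas = lookup-ext λ c → lookup-ext λ r →
    isBit-ext (decode-zeroOne (encode W) r c) (Feasible.zero-one feas r c) (mk⇔
      (from (encode-≢0 feas r c) ∘ to (decode-≢0 (encode W) r c))
      (from (decode-≢0 (encode W) r c) ∘ to (encode-≢0 feas r c)))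

  encode∘decode : ∀ {C} → Bounded C → encode (decode C) ≡ C
  encode∘decode {C} C≤ω = lookup-ext λ r → trans (encode-entry (decode C) r) (spec r (position? (decode C) r))
    where
    spec : ∀ r p → position {decode C} {r} p ≡ lookup C r
    spec r (yes (c , ≢0)) = sym (to (decode-≢0 C r c) ≢0)
    spec r (no none) with lookup C r in eq | C≤ω r
    ... | zero  | _   = refl
    ... | suc c | c<ω = contradiction (fromℕ< c<ω ,
            from (decode-≢0 C r _) (trans eq (cong suc (sym (toℕ-fromℕ< c<ω))))) none

  -- This is `same-column` for codes: two rows clash only if their codes are equal and non-zero. One
  -- number per row already enforces `same-row`.
  FeasibleCode : Code → Set
  FeasibleCode C = ∀ r r′ i → DifferOnlyAt i (coords d-1 k r) (coords d-1 k r′) →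
    lookup C r ≡ 0 ⊎ lookup C r ≢ lookup C r′ ⊎ ω ≤ ∣ lookup (coords d-1 k r) i - lookup (coords d-1 k r′) i ∣

  FeasibleCodeAt : ℕ → Code → Set
  FeasibleCodeAt j C = FeasibleCode C ×
    (∀ r c → lookup C r ≡ suc c → at ((j + c ∸ ω-1) ∷ coords d-1 k r) ≢ 0#)

  feasible-value : ∀ C → value (P.feasible C) ≡ true ⇔ FeasibleCode C
  feasible-value C = mk⇔
    (λ eq r r′ i differ → compatible-to r r′ i differ
      (to (if-dec (DifferOnlyAt? i (coords d-1 k r) (coords d-1 k r′)))
        (to (every-true {d-1} _) (to (every-true {K} _) (to (every-true {K} _) eq r) r′) i) differ))
    (λ feas → from (every-true {K} _) λ r → from (every-true {K} _) λ r′ → from (every-true {d-1} _) λ i →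
      from (if-dec (DifferOnlyAt? i (coords d-1 k r) (coords d-1 k r′)))
        (compatible-from r r′ i ∘ feas r r′ i))
    where
    if-dec : ∀ {Q : Set} (Q? : Dec Q) {e} → value (if does Q? then e else tt′) ≡ true ⇔ (Q → value e ≡ true)
    if-dec (yes q) = mk⇔ (λ eq _ → eq) (λ h → h q)
    if-dec (no ¬q) = mk⇔ (λ _ q → contradiction q ¬q) (λ _ → refl)
    module _ (r r′ : Fin K) (i : Fin d-1) where
      dist : ℕ
      dist = ∣ lookup (coords d-1 k r) i - lookup (coords d-1 k r′) i ∣
      e₁ e₂ e₃ e₄ : Exp ⟦_⟧ bool
      e₁ = P.at C r ≤ʷ lit 0
      e₂ = P.at C r +ʷ lit 1 ≤ʷ P.at C r′
      e₃ = P.at C r′ +ʷ lit 1 ≤ʷ P.at C r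
      e₄ = var ω ≤ʷ lit dist
      compatible-to : DifferOnlyAt i (coords d-1 k r) (coords d-1 k r′) → value (e₁ or e₂ or e₃ or e₄) ≡ true →
                      lookup C r ≡ 0 ⊎ lookup C r ≢ lookup C r′ ⊎ ω ≤ dist
      compatible-to _ eq with to (or-true e₁ (e₂ or e₃ or e₄)) eq
      ... | inj₁ eq₁ = inj₁ (n≤0⇒n≡0 (to ≤ᵇ-true eq₁))
      ... | inj₂ eq′ with to (or-true e₂ (e₃ or e₄)) eq′
      ...   | inj₁ eq₂ = inj₂ (inj₁ (<⇒≢ (to (+1≤ᵇ-true {lookup C r}) eq₂)))
      ...   | inj₂ eq″ with to (or-true e₃ e₄) eq″
      ...     | inj₁ eq₃ = inj₂ (inj₁ (>⇒≢ (to (+1≤ᵇ-true {lookup C r′}) eq₃)))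
      ...     | inj₂ eq₄ = inj₂ (inj₂ (to ≤ᵇ-true eq₄))
      compatible-from : lookup C r ≡ 0 ⊎ lookup C r ≢ lookup C r′ ⊎ ω ≤ dist → value (e₁ or e₂ or e₃ or e₄) ≡ true
      compatible-from (inj₁ ≡0) = from (or-true e₁ (e₂ or e₃ or e₄)) (inj₁ (from ≤ᵇ-true (≤-reflexive ≡0)))
      compatible-from (inj₂ (inj₂ ω≤)) = from (or-true e₁ (e₂ or e₃ or e₄)) (inj₂
        (from (or-true e₂ (e₃ or e₄)) (inj₂ (from (or-true e₃ e₄) (inj₂ (from ≤ᵇ-true ω≤))))))
      compatible-from (inj₂ (inj₁ neq)) = from (or-true e₁ (e₂ or e₃ or e₄)) (inj₂ (from (or-true e₂ (e₃ or e₄)) different))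
        where
        different : value e₂ ≡ true ⊎ value (e₃ or e₄) ≡ true
        different with <-cmp (lookup C r) (lookup C r′)
        ... | tri< lt _ _ = inj₁ (from +1≤ᵇ-true lt)
        ... | tri≈ _ eq _ = contradiction eq neq
        ... | tri> _ _ gt = inj₂ (from (or-true e₃ e₄) (inj₁ (from +1≤ᵇ-true gt)))

  input-entry : ∀ r {c} → c < n + ω → nth num (lookup input r) c ≡ at ((c ∸ ω-1) ∷ coords d-1 k r)
  input-entry r {c} c<n+ω = begin
    nth num (lookup input r) c
      ≡⟨ cong (λ xs → nth num xs c) (lookup∘tabulate (λ r → List.applyUpTo (λ c → lookup (col c) r) (n + ω)) r) ⟩
    nth num (List.applyUpTo (λ c → lookup (col c) r) (n + ω)) c
      ≡⟨ nth-applyUpTo num (λ c → lookup (col c) r) c<n+ω ⟩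
    lookup (col c) r
      ≡⟨ lookup∘tabulate (λ r → at ((c ∸ ω-1) ∷ coords d-1 k r)) r ⟩
    at ((c ∸ ω-1) ∷ coords d-1 k r) ∎
    where open ≡-Reasoning

  feasibleAt-value : ∀ e {j} → value e ≡ j → j ≤ n → ∀ C → Bounded C →
                     value (P.feasibleAt e C) ≡ true ⇔ FeasibleCodeAt j C
  feasibleAt-value e {j} refl j≤n C C≤ω = mk⇔
    (λ eq → let eq₁ , eq₂ = to (and-true (P.feasible C) (every allowed)) eq in
       to (feasible-value C) eq₁ , λ r c Cr≡ → to (allowed-value r) (to (every-true allowed) eq₂ r) c Cr≡)
    (λ (feas , all) → from (and-true (P.feasible C) (every allowed))
       (from (feasible-value C) feas , from (every-true allowed) λ r → from (allowed-value r) (all r)))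
    where
    entry : Fin K → Exp ⟦_⟧ num
    entry r = proj r (var input) ! (e +ʷ P.at C r ∸ʷ lit 1)
    allowed : Fin K → Exp ⟦_⟧ bool
    allowed r = (P.at C r ≤ʷ lit 0) or nonzero (entry r)
    entry-value : ∀ r c → lookup C r ≡ suc c → value (entry r) ≡ at ((j + c ∸ ω-1) ∷ coords d-1 k r)
    entry-value r c Cr≡ = trans (cong (nth num (lookup input r)) index)
      -- The access stays inside the stored row: j ≤ n, and the zero-based window column is below ω.
      (input-entry r (+-mono-≤-< j≤n (subst (_≤ ω) Cr≡ (C≤ω r))))
      where
      index : j + lookup C r ∸ 1 ≡ j + c
      index = trans (cong (λ x → j + x ∸ 1) Cr≡) (cong (_∸ 1) (+-suc j c))
    allowed-value : ∀ r → value (allowed r) ≡ true ⇔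
                    (∀ c → lookup C r ≡ suc c → at ((j + c ∸ ω-1) ∷ coords d-1 k r) ≢ 0#)
    allowed-value r = mk⇔ sound complete
      where
      nonzero-entry : ∀ c → lookup C r ≡ suc c →
        value (nonzero (entry r)) ≡ true ⇔ at ((j + c ∸ ω-1) ∷ coords d-1 k r) ≢ 0#
      nonzero-entry c Cr≡ = subst (λ x → value (nonzero (entry r)) ≡ true ⇔ x ≢ 0#) (entry-value r c Cr≡)
        (nonzero-true (entry r) (subst (0# ≤ⁿ_) (sym (entry-value r c Cr≡)) (at-nonneg _)))
      sound : value (allowed r) ≡ true → ∀ c → lookup C r ≡ suc c → at ((j + c ∸ ω-1) ∷ coords d-1 k r) ≢ 0#
      sound eq c Cr≡ with to (or-true (P.at C r ≤ʷ lit 0) (nonzero (entry r))) eq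
      ... | inj₁ eq₁ = contradiction (trans (sym Cr≡) (n≤0⇒n≡0 (to ≤ᵇ-true eq₁))) (λ ())
      ... | inj₂ eq₂ = to (nonzero-entry c Cr≡) eq₂
      complete : (∀ c → lookup C r ≡ suc c → at ((j + c ∸ ω-1) ∷ coords d-1 k r) ≢ 0#) → value (allowed r) ≡ true
      complete h = by-cases (lookup C r) refl
        where
        by-cases : ∀ x → lookup C r ≡ x → value (allowed r) ≡ true
        by-cases zero    Cr≡ = from (or-true (P.at C r ≤ʷ lit 0) (nonzero (entry r))) (inj₁ (from ≤ᵇ-true (≤-reflexive Cr≡)))
        by-cases (suc c) Cr≡ = from (or-true (P.at C r ≤ʷ lit 0) (nonzero (entry r))) (inj₂ (from (nonzero-entry c Cr≡) (h c Cr≡)))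

  feasible-decode : ∀ {j} C → Bounded C → FeasibleCodeAt j C ⇔ FeasibleAt j (decode C)
  feasible-decode {j} C C≤ω = mk⇔
    (λ (feas , allowed) → record
      { zero-one    = decode-zeroOne C
      ; same-row    = λ r c c′ c≢c′ ≢0 ≢0′ → contradiction
          (toℕ-injective (ℕ-suc-injective (trans (sym (to (decode-≢0 C r c) ≢0)) (to (decode-≢0 C r c′) ≢0′)))) c≢c′
      ; same-column = λ c r r′ ≢0 ≢0′ i differ → column-apart c r r′ i (to (decode-≢0 C r c) ≢0) (to (decode-≢0 C r′ c) ≢0′) (feas r r′ i differ)
      } , from (≤ₐ-window j (decode C) (decode-zeroOne C)) λ r c ≢0 → allowed r (toℕ c) (to (decode-≢0 C r c) ≢0))
    (λ (feas , ≤win) → (λ r r′ i differ → column-code feas r r′ i differ (lookup C r) refl (lookup C r ≟ lookup C r′)) ,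
      λ r c Cr≡ → let c<ω = subst (_≤ ω) Cr≡ (C≤ω r) in
        subst (λ c → at ((j + c ∸ ω-1) ∷ coords d-1 k r) ≢ 0#) (toℕ-fromℕ< c<ω)
          (to (≤ₐ-window j (decode C) (decode-zeroOne C)) ≤win r (fromℕ< c<ω)
            (from (decode-≢0 C r _) (trans Cr≡ (cong suc (sym (toℕ-fromℕ< c<ω)))))))
    where
    dist : Fin K → Fin K → Fin d-1 → ℕ
    dist r r′ i = ∣ lookup (coords d-1 k r) i - lookup (coords d-1 k r′) i ∣
    column-apart : ∀ (c : Fin ω) r r′ i → lookup C r ≡ suc (toℕ c) → lookup C r′ ≡ suc (toℕ c) →
                   lookup C r ≡ 0 ⊎ lookup C r ≢ lookup C r′ ⊎ ω ≤ dist r r′ i → ω ≤ dist r r′ i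
    column-apart c r r′ i Cr≡ Cr′≡ (inj₁ ≡0)         = contradiction (trans (sym Cr≡) ≡0) (λ ())
    column-apart c r r′ i Cr≡ Cr′≡ (inj₂ (inj₁ neq)) = contradiction (trans Cr≡ (sym Cr′≡)) neq
    column-apart c r r′ i Cr≡ Cr′≡ (inj₂ (inj₂ ω≤))  = ω≤
    column-code : Feasible (decode C) → ∀ r r′ i → DifferOnlyAt i (coords d-1 k r) (coords d-1 k r′) →
                  ∀ x → lookup C r ≡ x → Dec (lookup C r ≡ lookup C r′) →
                  lookup C r ≡ 0 ⊎ lookup C r ≢ lookup C r′ ⊎ ω ≤ dist r r′ i
    column-code feas r r′ i differ x       Cr≡ (no neq) = inj₂ (inj₁ neq)
    column-code feas r r′ i differ zero    Cr≡ (yes eq) = inj₁ Cr≡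
    column-code feas r r′ i differ (suc c) Cr≡ (yes eq) = inj₂ (inj₂ (Feasible.same-column feas (fromℕ< c<ω) r r′
        (from (decode-≢0 C r _) Cr≡′) (from (decode-≢0 C r′ _) (trans (sym eq) Cr≡′)) i differ))
      where
      c<ω = subst (_≤ ω) Cr≡ (C≤ω r)
      Cr≡′ = trans Cr≡ (cong suc (sym (toℕ-fromℕ< c<ω)))

  -- Table entries and the search for a best code

  entry : ⟦ P.Tab ⟧ → Code → Carrier × Code
  entry T C = value (var T P.‼ C)

  entry-allCodes : ∀ (e : Code → Exp ⟦_⟧ (num ⊗ P.Code)) C → Bounded C →
                   entry (value (P.allCodes e)) C ≡ value (e C)
  entry-allCodes e C C≤ω = trans
    (select-fillAll K (var ω +ʷ lit 1) (λ c → bind (tuple (λ r → var (lookup c r))) e)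
      (var (value (P.allCodes e))) (tabulate (P.at C)) refl
      (λ r → subst₂ _<_ (sym (at-value r)) (+-comm 1 ω) (s≤s (C≤ω r))))
    (cong (value ∘ e) (trans (tabulate∘lookup (Vec.map value (tabulate (P.at C))))
      (lookup-ext λ r → trans (lookup-map r value (tabulate (P.at C))) (at-value r))))
    where
    at-value : ∀ r → value (lookup (tabulate (P.at C)) r) ≡ lookup C r
    at-value r = cong value (lookup∘tabulate (P.at C) r)

  improve-preserves : ∀ (I : Carrier × Code → Set) e T W best → I best →
                      (value (P.feasibleAt e W) ≡ true → I (proj₁ (entry T W) , W)) →
                      I (value (P.improve e T W best))
  improve-preserves I e T W best Ibest IW = if-elim I (value (P.feasibleAt e W))
    (λ feas → if-elim I ⌊ proj₁ (entry T W) ≤ⁿ? proj₁ best ⌋ (λ _ → Ibest) (λ _ → IW feas))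
    (λ _ → Ibest)

  improve-increases : ∀ e T W best → proj₁ best ≤ⁿ proj₁ (value (P.improve e T W best))
  improve-increases e T W best = if-elim (λ s → proj₁ best ≤ⁿ proj₁ s) (value (P.feasibleAt e W))
    (λ feas → if-elim (λ s → proj₁ best ≤ⁿ proj₁ s) ⌊ proj₁ (entry T W) ≤ⁿ? proj₁ best ⌋ (λ _ → ≤ⁿ-refl) ≤ⁿ?-false)
    (λ _ → ≤ⁿ-refl)

  improve-considers : ∀ e T W best → value (P.feasibleAt e W) ≡ true →
                      proj₁ (entry T W) ≤ⁿ proj₁ (value (P.improve e T W best))
  improve-considers e T W best feas = if-elim (λ s → proj₁ (entry T W) ≤ⁿ proj₁ s) (value (P.feasibleAt e W))
    (λ _ → if-elim (λ s → proj₁ (entry T W) ≤ⁿ proj₁ s) ⌊ proj₁ (entry T W) ≤ⁿ? proj₁ best ⌋ ≤ⁿ?-true (λ _ → ≤ⁿ-refl))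
    (λ ≢true → contradiction feas ≢true)

  -- Common core of the predecessor search and of the final search: `g` turns loop indices into
  -- candidates and `z` supplies a valid start. The invariant also records that the number carried
  -- along is the table entry of the code carried along, so the best number is a value of `MIS`.
  module Search (e : Exp ⟦_⟧ word) (T : ⟦ P.Tab ⟧) (b : Exp ⟦_⟧ word) (z : Exp ⟦_⟧ (num ⊗ P.Code))
    (g : Code → Exp ⟦_⟧ P.Code) (Valid : Code → Set)
    (z≡ : value z ≡ (proj₁ (entry T (proj₂ (value z))) , proj₂ (value z))) (valid-z : Valid (proj₂ (value z)))
    (valid-g : ∀ is → Below (value b) is → value (P.feasibleAt e (value (g is))) ≡ true → Valid (value (g is)))
    where

    body : Code → ⟦ num ⊗ P.Code ⟧ → Exp ⟦_⟧ (num ⊗ P.Code)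
    body is best = bind (g is) λ W → P.improve e T W best

    best : Carrier × Code
    best = value (loopAll K b z body)

    best-valid : Valid (proj₂ best) × proj₁ best ≡ proj₁ (entry T (proj₂ best))
    best-valid = loopAll-invariant (λ s → Valid (proj₂ s) × proj₁ s ≡ proj₁ (entry T (proj₂ s))) K b z body
      (valid-z , cong proj₁ z≡)
      (λ is {s} is<b Is → improve-preserves (λ s → Valid (proj₂ s) × proj₁ s ≡ proj₁ (entry T (proj₂ s)))
        e T (value (g is)) s Is (λ feas → valid-g is is<b feas , refl))

    best-maximal : ∀ is → Below (value b) is → value (P.feasibleAt e (value (g is))) ≡ true →
                   proj₁ (entry T (value (g is))) ≤ⁿ proj₁ best
    best-maximal is is<b feas = loopAll-reaches (λ s → proj₁ (entry T (value (g is))) ≤ⁿ proj₁ s) K b z body is is<b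
      (λ s → improve-considers e T (value (g is)) s feas)
      (λ js {s} ≤s → ≤ⁿ-trans ≤s (improve-increases e T (value (g js)) s))

  module Predecessor (C : Code) (C≤ω : Bounded C) where

    -- Kept: the non-zero entry of row r is still in the window of the predecessor. Lost: the row is
    -- zero there except possibly in the first column.
    Kept Lost : Fin K → Set
    Kept r = 1 ≤ lookup C r × lookup C r < ω
    Lost r = ∀ c → lookup C r ≡ suc c → ω ≤ suc c

    predecessor-entry : ∀ b r → let D = value (P.predecessor C b) in
      (Kept r × lookup D r ≡ suc (lookup C r)) ⊎ (Lost r × lookup D r ≡ value (b r))
    predecessor-entry b r = subst (λ x → (Kept r × x ≡ suc (lookup C r)) ⊎ (Lost r × x ≡ value (b r)))
      (sym (lookup∘tabulate (λ r → value (cond (kept r) (P.at C r +ʷ lit 1) (b r))) r))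
      (if-elim (λ x → (Kept r × x ≡ suc (lookup C r)) ⊎ (Lost r × x ≡ value (b r))) (value (kept r))
        (λ eq → let eq₁ , eq₂ = to (kept-true r) eq in inj₁ ((eq₁ , eq₂) , +-comm _ 1))
        (λ ≢true → inj₂ ((λ c Cr≡ → ≮⇒≥ λ c<ω → ≢true (from (kept-true r)
          (subst (1 ≤_) (sym Cr≡) (s≤s z≤n) , subst (_< ω) (sym Cr≡) c<ω))) , refl)))
      where
      kept : Fin K → Exp ⟦_⟧ bool
      kept r = (lit 1 ≤ʷ P.at C r) and (P.at C r +ʷ lit 1 ≤ʷ var ω)
      kept-true : ∀ r → value (kept r) ≡ true ⇔ Kept r
      kept-true r = mk⇔
        (λ eq → let eq₁ , eq₂ = to (and-true (lit 1 ≤ʷ P.at C r) (P.at C r +ʷ lit 1 ≤ʷ var ω)) eq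
                in  to ≤ᵇ-true eq₁ , to (+1≤ᵇ-true {lookup C r}) eq₂)
        (λ (1≤ , <ω) → from (and-true (lit 1 ≤ʷ P.at C r) (P.at C r +ʷ lit 1 ≤ʷ var ω))
           (from ≤ᵇ-true 1≤ , from (+1≤ᵇ-true {lookup C r}) <ω))

    predecessor-bounded : ∀ b → (∀ r → value (b r) ≤ 1) → Bounded (value (P.predecessor C b))
    predecessor-bounded b b≤1 r with predecessor-entry b r
    ... | inj₁ ((_ , <ω) , Dr≡) = subst (_≤ ω) (sym Dr≡) <ω
    ... | inj₂ (_ , Dr≡)        = subst (_≤ ω) (sym Dr≡) (≤-trans (b≤1 r) (s≤s z≤n))

    -- A chosen bit gives a code at most 1, hence affects only the first column, which consistency
    -- ignores; kept entries are moved by exactly one column.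
    predecessor-⊨ : ∀ b → (∀ r → value (b r) ≤ 1) → decode (value (P.predecessor C b)) ⊨ decode C
    predecessor-⊨ b b≤1 = from (⊨-entries (decode D) (decode C)) λ r c →
      isBit-ext (decode-zeroOne D r (suc c)) (decode-zeroOne C r (inject₁ c)) (mk⇔
        (from (decode-≢0 C r (inject₁ c)) ∘ (λ eq → trans eq (cong suc (sym (toℕ-inject₁ c)))) ∘ forward r c ∘ to (decode-≢0 D r (suc c)))
        (from (decode-≢0 D r (suc c)) ∘ backward r c ∘ (λ eq → trans eq (cong suc (toℕ-inject₁ c))) ∘ to (decode-≢0 C r (inject₁ c))))
      where
      D = value (P.predecessor C b)
      forward : ∀ r (c : Fin ω-1) → lookup D r ≡ suc (suc (toℕ c)) → lookup C r ≡ suc (toℕ c)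
      forward r c Dr≡ with predecessor-entry b r
      ... | inj₁ (_ , Dr≡′) = ℕ-suc-injective (trans (sym Dr≡′) Dr≡)
      ... | inj₂ (_ , Dr≡′) = contradiction (subst (_≤ 1) (trans (sym Dr≡′) Dr≡) (b≤1 r)) λ { (s≤s ()) }
      backward : ∀ r (c : Fin ω-1) → lookup C r ≡ suc (toℕ c) → lookup D r ≡ suc (suc (toℕ c))
      backward r c Cr≡ with predecessor-entry b r
      ... | inj₁ (_ , Dr≡)    = trans Dr≡ (cong suc Cr≡)
      ... | inj₂ (lost , _) = contradiction (lost (toℕ c) Cr≡) (<⇒≱ (s≤s (toℕ<n c)))

    -- The loop bits that reproduce `W`. In a lost row the code is 0 or 1 and is preserved by the
    -- minimum; in a kept row the bit is overridden by the shifted entry.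
    firstColumn : Array ω → Code
    firstColumn W = tabulate λ r → lookup (encode W) r ⊓ 1

    firstColumn-below : ∀ W → Below 2 (firstColumn W)
    firstColumn-below W r = subst (_< 2) (sym (lookup∘tabulate _ r)) (s≤s (m⊓n≤n (lookup (encode W) r) 1))

    -- The search misses no candidate. Consistency fixes the entry of a kept row, and in a lost row
    -- a code of 2 or more would correspond to an entry of `C` that is kept.
    predecessor-complete : ∀ W → Feasible W → W ⊨ decode C →
                           value (P.predecessor C (λ r → var (lookup (firstColumn W) r))) ≡ encode W
    predecessor-complete W feas W⊨C = lookup-ext λ r → by-cases r (predecessor-entry b r)
      where
      b : Fin K → Exp ⟦_⟧ word
      b r = var (lookup (firstColumn W) r)
      D = value (P.predecessor C b)
      shifted : ∀ r (c : Fin ω-1) → W [ r , suc c ] ≢ 0# ⇔ lookup C r ≡ suc (toℕ c)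
      shifted r c = subst₂ (λ x y → x ≢ 0# ⇔ lookup C r ≡ suc y)
        (sym (to (⊨-entries W (decode C)) W⊨C r c)) (toℕ-inject₁ c) (decode-≢0 C r (inject₁ c))
      kept-entry : ∀ r x → lookup C r ≡ x → 1 ≤ x → x < ω → lookup (encode W) r ≡ suc x
      kept-entry r (suc c) Cr≡ _ (s≤s c<ω-1) = trans
        (to (encode-≢0 feas r (suc (fromℕ< c<ω-1)))
          (from (shifted r (fromℕ< c<ω-1)) (trans Cr≡ (cong suc (sym (toℕ-fromℕ< c<ω-1))))))
        (cong (λ c → suc (suc c)) (toℕ-fromℕ< c<ω-1))
      lost-entry : ∀ r → Lost r → ∀ x → lookup (encode W) r ≡ x → x ≤ ω → x ⊓ 1 ≡ x
      lost-entry r lost zero          Er≡ _ = refl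
      lost-entry r lost (suc zero)    Er≡ _ = refl
      lost-entry r lost (suc (suc c)) Er≡ (s≤s c<ω-1) = contradiction
        (lost c (trans (to (shifted r (fromℕ< c<ω-1)) (from (encode-≢0 feas r (suc (fromℕ< c<ω-1)))
          (trans Er≡ (cong (λ c → suc (suc c)) (sym (toℕ-fromℕ< c<ω-1)))))) (cong suc (toℕ-fromℕ< c<ω-1))))
        (<⇒≱ (s≤s c<ω-1))
      by-cases : ∀ r → (Kept r × lookup D r ≡ suc (lookup C r)) ⊎ (Lost r × lookup D r ≡ value (b r)) →
                 lookup D r ≡ lookup (encode W) r
      by-cases r (inj₁ ((1≤ , <ω) , Dr≡)) = trans Dr≡ (sym (kept-entry r _ refl 1≤ <ω))
      by-cases r (inj₂ (lost , Dr≡)) = trans Dr≡ (trans (lookup∘tabulate _ r) (lost-entry r lost _ refl (encode-bounded W r)))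

    -- Needed as the start of the search. The surviving entries keep their locations in the network,
    -- and raising their codes by one preserves which codes differ.
    shift-feasible : ∀ {j} → FeasibleCodeAt (suc j) C → FeasibleCodeAt j (value (P.predecessor C (λ _ → lit 0)))
    shift-feasible {j} (feas , allowed) = feas₀ , allowed₀
      where
      D = value (P.predecessor C (λ _ → lit 0))
      moved : ∀ r → lookup D r ≡ 0 ⊎ (1 ≤ lookup C r × lookup D r ≡ suc (lookup C r))
      moved r with predecessor-entry (λ _ → lit 0) r
      ... | inj₁ ((1≤ , _) , Dr≡) = inj₂ (1≤ , Dr≡)
      ... | inj₂ (_ , Dr≡)        = inj₁ Dr≡
      feas₀ : FeasibleCode D
      feas₀ r r′ i differ with moved r | moved r′ | feas r r′ i differ
      ... | inj₁ ≡0        | _                | _                = inj₁ ≡0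
      ... | inj₂ (_ , Dr≡) | inj₁ ≡0          | _                =
              inj₂ (inj₁ λ eq → contradiction (trans (sym Dr≡) (trans eq ≡0)) (λ ()))
      ... | inj₂ (1≤ , _)  | inj₂ _           | inj₁ ≡0          = contradiction (subst (1 ≤_) ≡0 1≤) (λ ())
      ... | inj₂ (_ , Dr≡) | inj₂ (_ , Dr′≡)  | inj₂ (inj₁ neq)  =
              inj₂ (inj₁ λ eq → neq (ℕ-suc-injective (trans (sym Dr≡) (trans eq Dr′≡))))
      ... | inj₂ _         | inj₂ _           | inj₂ (inj₂ ω≤)   = inj₂ (inj₂ ω≤)
      allowed₀ : ∀ r c → lookup D r ≡ suc c → at ((j + c ∸ ω-1) ∷ coords d-1 k r) ≢ 0#
      allowed₀ r c Dr≡ with moved r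
      ... | inj₁ ≡0 = contradiction (trans (sym Dr≡) ≡0) (λ ())
      ... | inj₂ (1≤ , Dr≡′) = by-cases c (ℕ-suc-injective (trans (sym Dr≡′) Dr≡))
        where
        by-cases : ∀ c → lookup C r ≡ c → at ((j + c ∸ ω-1) ∷ coords d-1 k r) ≢ 0#
        by-cases zero     Cr≡ = contradiction (subst (1 ≤_) Cr≡ 1≤) (λ ())
        -- Index c′+1 in the window ending at `j` is index c′ in the window ending at j+1.
        by-cases (suc c′) Cr≡ = subst (λ x → at ((x ∸ ω-1) ∷ coords d-1 k r) ≢ 0#) (sym (+-suc j c′)) (allowed r c′ Cr≡)

  feasibleAt-var : ∀ {j} → j ≤ n → ∀ C → Bounded C →
                   value (P.feasibleAt (var j) C) ≡ true ⇔ FeasibleAt j (decode C)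
  feasibleAt-var {j} j≤n C C≤ω = mk⇔
    (to (feasible-decode C C≤ω) ∘ to (feasibleAt-value (var j) refl j≤n C C≤ω))
    (from (feasibleAt-value (var j) refl j≤n C C≤ω) ∘ from (feasible-decode C C≤ω))

  tab : ℕ → ⟦ P.Tab ⟧
  tab zero    = value P.start
  tab (suc j) = value (P.step j (tab j))

  module BestPredecessor (j : ℕ) (j<n : j < n) (C : Code) (C≤ω : Bounded C) (feasC : FeasibleCodeAt (suc j) C) where
    open Predecessor C C≤ω

    Valid : Code → Set
    Valid D = Bounded D × FeasibleAt j (decode D) × decode D ⊨ decode C

    g : Code → Exp ⟦_⟧ P.Code
    g b = P.predecessor C (λ r → var (lookup b r))

    shift : Code
    shift = value (P.predecessor C (λ _ → lit 0))

    shift-bounded : Bounded shift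
    shift-bounded = predecessor-bounded (λ _ → lit 0) (λ _ → z≤n)

    shift-valid : Valid shift
    shift-valid = shift-bounded , to (feasible-decode shift shift-bounded) (shift-feasible feasC) ,
      predecessor-⊨ (λ _ → lit 0) (λ _ → z≤n)

    g-valid : ∀ is → Below 2 is → value (P.feasibleAt (var j) (value (g is))) ≡ true → Valid (value (g is))
    g-valid is is<2 feas = bounded , to (feasibleAt-var (<⇒≤ j<n) (value (g is)) bounded) feas ,
      predecessor-⊨ (λ r → var (lookup is r)) (λ r → s≤s⁻¹ (is<2 r))
      where
      bounded : Bounded (value (g is))
      bounded = predecessor-bounded (λ r → var (lookup is r)) (λ r → s≤s⁻¹ (is<2 r))

    open Search (var j) (tab j) (lit 2)
      (bind (P.predecessor C (λ _ → lit 0)) λ W₀ → pair (fst (var (tab j) P.‼ W₀)) (var W₀))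
      g Valid refl shift-valid g-valid
      public using (best; best-valid; best-maximal)

    best-maximal-⊨ : ∀ W → FeasibleAt j W → W ⊨ decode C → proj₁ (entry (tab j) (encode W)) ≤ⁿ proj₁ best
    best-maximal-⊨ W feasW W⊨C = subst (λ D → proj₁ (entry (tab j) D) ≤ⁿ proj₁ best) eq
      (best-maximal (firstColumn W) (firstColumn-below W) (subst (λ D → value (P.feasibleAt (var j) D) ≡ true) (sym eq)
        (from (feasibleAt-var (<⇒≤ j<n) (encode W) (encode-bounded W)) (subst (FeasibleAt j) (sym (decode∘encode (proj₁ feasW))) feasW))))
      where
      eq : value (g (firstColumn W)) ≡ encode W
      eq = predecessor-complete W (proj₁ feasW) W⊨C

  -- For a bounded code the test ω ≤ code means code = ω, the last column.
  lastColumn-value : ∀ C → Bounded C → value (P.lastColumn C) ≡ Vec.last (decode C)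
  lastColumn-value C C≤ω = lookup-ext λ r → begin
    lookup (value (P.lastColumn C)) r  ≡⟨ lookup∘tabulate (λ r → bit (ω ≤ᵇ lookup C r)) r ⟩
    bit (ω ≤ᵇ lookup C r)              ≡⟨ isBit-ext (bit-isBit _) (decode-zeroOne C r (fromℕ ω-1)) (same r) ⟩
    decode C [ r , fromℕ ω-1 ]         ≡⟨ cong (λ X → lookup X r) (last-lookup (decode C)) ⟨
    lookup (Vec.last (decode C)) r     ∎
    where
    open ≡-Reasoning
    bit-true : ∀ b → bit b ≢ 0# ⇔ b ≡ true
    bit-true true  = mk⇔ (λ _ → refl) (λ _ → 0≢1 ∘ sym)
    bit-true false = mk⇔ (λ ≢0 → contradiction refl ≢0) (λ ())
    same : ∀ r → bit (ω ≤ᵇ lookup C r) ≢ 0# ⇔ decode C [ r , fromℕ ω-1 ] ≢ 0#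
    same r = mk⇔
      (λ ≢0 → from (decode-≢0 C r (fromℕ ω-1)) (trans (≤-antisym (C≤ω r) (to ≤ᵇ-true (to (bit-true _) ≢0)))
                (cong suc (sym (toℕ-fromℕ ω-1)))))
      (λ ≢0 → from (bit-true _) (from ≤ᵇ-true (≤-reflexive (sym (trans (to (decode-≢0 C r (fromℕ ω-1)) ≢0)
                (cong suc (toℕ-fromℕ ω-1)))))))

  gain-value : ∀ e {j} → value e ≡ suc j → j < n → ∀ C → Bounded C →
               value (P.gain e C) ≡ ⟨ Vec.last (decode C) , column (suc j) ⟩
  gain-value e {j} e≡ j<n C C≤ω = trans (total-sum summand) (sum-cong-≗ λ r →
    cong₂ _*ⁿ_ (cong (λ X → lookup X r) (lastColumn-value C C≤ω)) (factor r))
    where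
    summand : Fin K → Exp ⟦_⟧ num
    summand r = proj r (var (value (P.lastColumn C))) *′ (proj r (var input) ! (e +ʷ var ω ∸ʷ lit 1))
    factor : ∀ r → nth num (lookup input r) (value e + ω ∸ 1) ≡ lookup (column (suc j)) r
    factor r = begin
      nth num (lookup input r) (value e + ω ∸ 1)
        ≡⟨ cong (nth num (lookup input r)) (trans (cong (λ x → x + ω ∸ 1) e≡) (+-suc j ω-1)) ⟩
      nth num (lookup input r) (suc j + ω-1)
        ≡⟨ input-entry r (+-mono-≤-< j<n ≤-refl) ⟩
      at ((suc j + ω-1 ∸ ω-1) ∷ coords d-1 k r)
        ≡⟨ lookup∘tabulate (λ r → at ((suc j + ω-1 ∸ ω-1) ∷ coords d-1 k r)) r ⟨
      lookup (column (suc j)) r ∎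
      where open ≡-Reasoning

  module _ (j : ℕ) (j<n : j < n) (C : Code) (C≤ω : Bounded C) where

    private
      check : Exp ⟦_⟧ word
      check = var j +ʷ lit 1
      check≡ : value check ≡ suc j
      check≡ = +-comm j 1

    entry-step : (feasC : FeasibleCodeAt (suc j) C) → let open BestPredecessor j j<n C C≤ω feasC in
      entry (tab (suc j)) C ≡ (⟨ Vec.last (decode C) , column (suc j) ⟩ +ⁿ proj₁ best , proj₂ best)
    entry-step feasC = trans (entry-allCodes _ C C≤ω)
      (trans (if-true (from (feasibleAt-value check check≡ j<n C C≤ω) feasC))
        (cong (λ x → x +ⁿ proj₁ best , proj₂ best) (gain-value check check≡ j<n C C≤ω)))
      where open BestPredecessor j j<n C C≤ω feasC

    entry-default : ¬ FeasibleCodeAt (suc j) C → proj₁ (entry (tab (suc j)) C) ≡ 0#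
    entry-default infeasC = cong proj₁ (trans (entry-allCodes _ C C≤ω)
      (if-false (infeasC ∘ to (feasibleAt-value check check≡ j<n C C≤ω))))

  -- A `Run` speaks of arrays and the tables of codes; the two round trips between `encode` and
  -- `decode` transfer the fields.
  MIS : ℕ → Array ω → Carrier
  MIS j W = proj₁ (entry (tab j) (encode W))

  pred : ℕ → Array ω → Array ω
  pred j W = decode (proj₂ (entry (tab j) (encode W)))

  module Final where
    Valid : Code → Set
    Valid D = Bounded D × FeasibleAt n (decode D)

    g : Code → Exp ⟦_⟧ P.Code
    g c = tuple (λ r → var (lookup c r))

    zero-entry : ∀ r → lookup (value P.zeroCode) r ≡ 0
    zero-entry r = lookup∘tabulate (λ _ → 0) r

    zero-bounded : Bounded (value P.zeroCode)
    zero-bounded r = subst (_≤ ω) (sym (zero-entry r)) z≤n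

    zero-valid : Valid (value P.zeroCode)
    zero-valid = zero-bounded , to (feasible-decode (value P.zeroCode) zero-bounded)
      ((λ r _ _ _ → inj₁ (zero-entry r)) , λ r c ≡suc → contradiction (trans (sym (zero-entry r)) ≡suc) (λ ()))

    g-bounded : ∀ is → Below (ω + 1) is → Bounded (value (g is))
    g-bounded is is< r = subst (_≤ ω) (sym (lookup∘tabulate (lookup is) r)) (s≤s⁻¹ (subst (lookup is r <_) (+-comm ω 1) (is< r)))

    open Search (var n) (tab n) (var ω +ʷ lit 1)
      (bind P.zeroCode λ W₀ → pair (fst (var (tab n) P.‼ W₀)) (var W₀))
      g Valid refl zero-valid
      (λ is is< feas → g-bounded is is< , to (feasibleAt-var ≤-refl (value (g is)) (g-bounded is is<)) feas)
      public using (best; best-valid; best-maximal)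

    code : Code
    code = proj₂ best

    maximal : ∀ W → FeasibleAt n W → MIS n W ≤ⁿ proj₁ (entry (tab n) code)
    maximal W feasW = subst₂ _≤ⁿ_ (cong (λ D → proj₁ (entry (tab n) D)) eq) (proj₂ best-valid)
      (best-maximal (encode W) (λ r → subst (lookup (encode W) r <_) (+-comm 1 ω) (s≤s (encode-bounded W r)))
        (subst (λ D → value (P.feasibleAt (var n) D) ≡ true) (sym eq)
          (from (feasibleAt-var ≤-refl (encode W) (encode-bounded W)) (subst (FeasibleAt n) (sym (decode∘encode (proj₁ feasW))) feasW))))
      where
      eq : value (g (encode W)) ≡ encode W
      eq = tabulate∘lookup (encode W)

  private
    feasible-encode : ∀ {j W} → FeasibleAt j W → FeasibleCodeAt j (encode W)
    feasible-encode {j} {W} feasW = from (feasible-decode (encode W) (encode-bounded W)) (subst (FeasibleAt j) (sym (decode∘encode (proj₁ feasW))) feasW)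

    module Best (j : ℕ) (W : Array ω) (j<n : j < n) (feasW : FeasibleAt (suc j) W) where
      open BestPredecessor j j<n (encode W) (encode-bounded W) (feasible-encode feasW) public
      step≡ : entry (tab (suc j)) (encode W) ≡ (⟨ Vec.last (decode (encode W)) , column (suc j) ⟩ +ⁿ proj₁ best , proj₂ best)
      step≡ = entry-step j j<n (encode W) (encode-bounded W) (feasible-encode feasW)
      pred≡ : pred (suc j) W ≡ decode (proj₂ best)
      pred≡ = cong (decode ∘ proj₂) step≡
      MIS-pred≡ : MIS j (pred (suc j) W) ≡ proj₁ best
      MIS-pred≡ = trans (cong (MIS j) pred≡)
        (trans (cong (proj₁ ∘ entry (tab j)) (encode∘decode (proj₁ (proj₁ best-valid)))) (sym (proj₂ best-valid)))

  run : Run G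
  run = record
    { MIS             = MIS
    ; pred            = pred
    ; MIS-start       = cong proj₁ (entry-allCodes _ (encode (zeros ω)) (encode-bounded (zeros ω)))
    ; MIS-default     = λ { (suc j) W _ j<n feas infeas → entry-default j j<n (encode W) (encode-bounded W)
                          (λ feasC → infeas (subst (FeasibleAt (suc j)) (decode∘encode feas) (to (feasible-decode (encode W) (encode-bounded W)) feasC))) }
    ; pred-feasible   = λ j W j<n feasW → let open Best j W j<n feasW in
                          subst (FeasibleAt j) (sym pred≡) (proj₁ (proj₂ (proj₁ best-valid)))
    ; pred-consistent = λ j W j<n feasW → let open Best j W j<n feasW in
                          subst₂ _⊨_ (sym pred≡) (decode∘encode (proj₁ feasW)) (proj₂ (proj₂ (proj₁ best-valid)))
    ; pred-maximal    = λ j W j<n feasW W′ feasW′ W′⊨W → let open Best j W j<n feasW in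
                          subst (MIS j W′ ≤ⁿ_) (sym MIS-pred≡)
                            (best-maximal-⊨ W′ feasW′ (subst (W′ ⊨_) (sym (decode∘encode (proj₁ feasW))) W′⊨W))
    ; MIS-step        = λ j W j<n feasW → let open Best j W j<n feasW in
                          trans (cong proj₁ step≡) (cong₂ (λ X x → ⟨ Vec.last X , column (suc j) ⟩ +ⁿ x)
                            (decode∘encode (proj₁ feasW)) (sym MIS-pred≡))
    ; final           = decode Final.code
    ; final-feasible  = proj₂ (proj₁ Final.best-valid)
    ; final-maximal   = λ W feasW → subst (λ D → MIS n W ≤ⁿ proj₁ (entry (tab n) D))
                          (sym (encode∘decode (proj₁ (proj₁ Final.best-valid)))) (Final.maximal W feasW)
    }

  -- The list of tables and the retrieval loop

  tabs : ℕ → List ⟦ P.Tab ⟧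
  tabs zero    = tab 0 ∷ []
  tabs (suc j) = tab (suc j) ∷ tabs j

  tables-value : ∀ m → iterate m (tab 0 ∷ []) (λ j Ts → value (P.step j (nth P.Tab Ts 0)) ∷ Ts) ≡ tabs m
  tables-value zero    = refl
  tables-value (suc m) = trans
    (cong (λ Ts → value (P.step m (nth P.Tab Ts 0)) ∷ Ts) (tables-value m))
    (cong (λ T → value (P.step m T) ∷ tabs m) (head-tabs m))
    where
    head-tabs : ∀ m → nth P.Tab (tabs m) 0 ≡ tab m
    head-tabs zero    = refl
    head-tabs (suc m) = refl

  State : Set
  State = List ⟦ P.Tab ⟧ × Code × List Column

  retrieveStep : State → State
  retrieveStep (Ts , C , I) =
    rest Ts , C′ , value (P.lastColumn C′) ∷ I
    where
    C′ : Code
    C′ = proj₂ (value (head (var Ts) P.‼ C))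

  -- The program conses columns onto an accumulator while `retrieve` appends them, so the statement
  -- is generalised over `I`. Each step reads the predecessor from the table at the head of the list
  -- and then drops that table.
  retrieval-value : ∀ j → j < n → ∀ C → Bounded C → FeasibleAt (suc j) (decode C) → ∀ I →
    proj₂ (proj₂ (iterate j (tabs (suc j) , C , value (P.lastColumn C) ∷ I) (λ _ → retrieveStep)))
    ≡ toList (Run.retrieve run j (decode C)) ++ I
  retrieval-value zero    j<n C C≤ω feasC I = cong (_∷ I) (lastColumn-value C C≤ω)
  retrieval-value (suc j) j<n C C≤ω feasC I = begin
    proj₂ (proj₂ (iterate (suc j) (tabs (suc (suc j)) , C , value (P.lastColumn C) ∷ I) (λ _ → retrieveStep)))
      -- `iterate` peels off the last iteration, but the induction needs the first; the body does
      -- not depend on the counter, so they can be exchanged.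
      ≡⟨ cong (proj₂ ∘ proj₂) (iterate-const j _ retrieveStep) ⟩
    proj₂ (proj₂ (iterate j (retrieveStep (tabs (suc (suc j)) , C , value (P.lastColumn C) ∷ I)) (λ _ → retrieveStep)))
      ≡⟨ cong (λ D → proj₂ (proj₂ (iterate j (tabs (suc j) , D , value (P.lastColumn D) ∷ value (P.lastColumn C) ∷ I) (λ _ → retrieveStep)))) C′≡ ⟩
    proj₂ (proj₂ (iterate j (tabs (suc j) , C′ , value (P.lastColumn C′) ∷ value (P.lastColumn C) ∷ I) (λ _ → retrieveStep)))
      ≡⟨ retrieval-value j (<⇒≤ j<n) C′ (proj₁ (proj₁ best-valid)) (proj₁ (proj₂ (proj₁ best-valid))) (value (P.lastColumn C) ∷ I) ⟩
    toList (Run.retrieve run j (decode C′)) ++ value (P.lastColumn C) ∷ I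
      ≡⟨ cong₂ (λ W c → toList (Run.retrieve run j W) ++ c ∷ I) (sym pred≡) (lastColumn-value C C≤ω) ⟩
    toList (Run.retrieve run j (pred (suc (suc j)) (decode C))) ++ Vec.last (decode C) ∷ I
      ≡⟨ ++-assoc (toList (Run.retrieve run j (pred (suc (suc j)) (decode C)))) (Vec.last (decode C) ∷ []) I ⟨
    (toList (Run.retrieve run j (pred (suc (suc j)) (decode C))) ++ Vec.last (decode C) ∷ []) ++ I
      ≡⟨ cong (_++ I) (toList-∷ʳ (Vec.last (decode C)) (Run.retrieve run j (pred (suc (suc j)) (decode C)))) ⟨
    toList (Run.retrieve run (suc j) (decode C)) ++ I ∎
    where
    open ≡-Reasoning
    open BestPredecessor (suc j) j<n C C≤ω (from (feasible-decode C C≤ω) feasC) using (best; best-valid)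
    C′ : Code
    C′ = proj₂ best
    entry≡ : proj₂ (entry (tab (suc (suc j))) C) ≡ C′
    entry≡ = cong proj₂ (entry-step (suc j) j<n C C≤ω (from (feasible-decode C C≤ω) feasC))
    C′≡ : proj₂ (value (head (var (tabs (suc (suc j)))) P.‼ C)) ≡ C′
    C′≡ = trans (cong proj₂ (select-cong (head (var (tabs (suc (suc j))))) (var (tab (suc (suc j)))) (tabulate (P.at C)) refl)) entry≡
    pred≡ : pred (suc (suc j)) (decode C) ≡ decode C′
    pred≡ = cong decode (trans (cong (proj₂ ∘ entry (tab (suc (suc j)))) (encode∘decode C≤ω)) entry≡)

  -- The remainder of the algorithm as a function of the tables, so that `tables-value` can be
  -- applied under it.
  afterTables : List ⟦ P.Tab ⟧ → Exp ⟦_⟧ (list (num ⋆ K))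
  afterTables Ts = bind (head {τ = P.Tab} (var Ts)) λ T → bind (P.finalCode T) λ W* → P.retrieval Ts W*

  result≡ : result ≡ toList (Run.output run)
  result≡ = begin
    result
      ≡⟨ cong (value ∘ afterTables) (tables-value n) ⟩
    value (P.retrieval (tabs n) Final.code)
      ≡⟨ retrieval-value n-1 ≤-refl Final.code (proj₁ (proj₁ Final.best-valid)) (proj₂ (proj₁ Final.best-valid)) [] ⟩
    toList (Run.output run) ++ []
      ≡⟨ ++-identityʳ _ ⟩
    toList (Run.output run) ∎
    where open ≡-Reasoning

-- Running time

^-distribʳ-* : ∀ m n o → (n * o) ^ m ≡ n ^ m * o ^ m
^-distribʳ-* zero    n o = refl
^-distribʳ-* (suc m) n o = trans (cong (n * o *_) (^-distribʳ-* m n o)) ([m*n]*[o*p]≡[m*o]*[n*p] n o (n ^ m) (o ^ m))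

-- A record keeps the expression and its bound as parameters that unification can read off, where a
-- bare inequality would unfold `cost`.
record Costs (R : OrderedRing) {τ : Ty} (e : Exp (Semantics.⟦_⟧ R) τ) (c : ℕ) : Set where
  constructor costs
  field cost≤ : Semantics.cost R e ≤ c
open Costs

module CostRules {R : OrderedRing} where
  open Semantics R

  private
    E : Ty → Set
    E = Exp ⟦_⟧
    infix 4 _≼_
    _≼_ : ∀ {τ} → E τ → ℕ → Set
    _≼_ = Costs R
    variable
      σ τ : Ty
      m a b c : ℕ

  1+-mono : ∀ {x y} → x ≤ a → y ≤ b → 1 + x + y ≤ 1 + a + b
  1+-mono x≤a y≤b = s≤s (+-mono-≤ x≤a y≤b)

  weaken : {e : E τ} → a ≤ b → e ≼ a → e ≼ b
  weaken a≤b (costs e≼) = costs (≤-trans e≼ a≤b)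

  var-costs : {x : ⟦ τ ⟧} → var {τ = τ} x ≼ 1
  var-costs = costs ≤-refl

  bind-costs : {e : E σ} {f : ⟦ σ ⟧ → E τ} → e ≼ a → (∀ v → f v ≼ b) → bind e f ≼ 1 + a + b
  bind-costs (costs e≼) f≼ = costs (1+-mono e≼ (cost≤ (f≼ _)))

  lit-costs : lit c ≼ 1
  lit-costs = costs ≤-refl

  +ʷ-costs : {e e′ : E word} → e ≼ a → e′ ≼ b → e +ʷ e′ ≼ 1 + a + b
  +ʷ-costs (costs e≼) (costs e′≼) = costs (1+-mono e≼ e′≼)

  ∸ʷ-costs : {e e′ : E word} → e ≼ a → e′ ≼ b → e ∸ʷ e′ ≼ 1 + a + b
  ∸ʷ-costs (costs e≼) (costs e′≼) = costs (1+-mono e≼ e′≼)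

  ≤ʷ-costs : {e e′ : E word} → e ≼ a → e′ ≼ b → (e ≤ʷ e′) ≼ 1 + a + b
  ≤ʷ-costs (costs e≼) (costs e′≼) = costs (1+-mono e≼ e′≼)

  zero-costs : zero′ ≼ 1
  zero-costs = costs ≤-refl

  one-costs : one′ ≼ 1
  one-costs = costs ≤-refl

  +′-costs : {e e′ : E num} → e ≼ a → e′ ≼ b → e +′ e′ ≼ 1 + a + b
  +′-costs (costs e≼) (costs e′≼) = costs (1+-mono e≼ e′≼)

  *′-costs : {e e′ : E num} → e ≼ a → e′ ≼ b → e *′ e′ ≼ 1 + a + b
  *′-costs (costs e≼) (costs e′≼) = costs (1+-mono e≼ e′≼)

  ≤′-costs : {e e′ : E num} → e ≼ a → e′ ≼ b → (e ≤′ e′) ≼ 1 + a + b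
  ≤′-costs (costs e≼) (costs e′≼) = costs (1+-mono e≼ e′≼)

  tt-costs : tt′ ≼ 1
  tt-costs = costs ≤-refl

  ff-costs : ff′ ≼ 1
  ff-costs = costs ≤-refl

  cond-costs : {e : E bool} {t u : E τ} → e ≼ a → t ≼ b → u ≼ c → cond e t u ≼ 1 + a + (b ⊔ c)
  cond-costs {b = b} {c = c} {e} {t} {u} (costs e≼) (costs t≼) (costs u≼) = costs (1+-mono e≼ (branch (value e)))
    where
    branch : ∀ v → (if v then cost t else cost u) ≤ b ⊔ c
    branch true  = ≤-trans t≼ (m≤m⊔n b c)
    branch false = ≤-trans u≼ (m≤n⊔m b c)

  pair-costs : {e : E σ} {e′ : E τ} → e ≼ a → e′ ≼ b → pair e e′ ≼ 1 + a + b
  pair-costs (costs e≼) (costs e′≼) = costs (1+-mono e≼ e′≼)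

  fst-costs : {e : E (σ ⊗ τ)} → e ≼ a → fst e ≼ 1 + a
  fst-costs (costs e≼) = costs (s≤s e≼)

  snd-costs : {e : E (σ ⊗ τ)} → e ≼ a → snd e ≼ 1 + a
  snd-costs (costs e≼) = costs (s≤s e≼)

  tuple-costs : {es : Fin m → E τ} → (∀ r → es r ≼ c) → tuple es ≼ 1 + m * c
  tuple-costs es≼ = costs (s≤s (sum-tabulate-≤ _ (cost≤ ∘ es≼)))
    where
    sum-tabulate-≤ : ∀ m {g : Fin m → ℕ} → (∀ r → g r ≤ c) → Vec.sum (tabulate g) ≤ m * c
    sum-tabulate-≤ zero    g≤ = z≤n
    sum-tabulate-≤ (suc m) g≤ = +-mono-≤ (g≤ zero) (sum-tabulate-≤ m (g≤ ∘ suc))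

  proj-costs : {r : Fin m} {e : E (τ ⋆ m)} → e ≼ a → proj r e ≼ 1 + a
  proj-costs (costs e≼) = costs (s≤s e≼)

  !-costs : {e : E (arr τ)} {i : E word} → e ≼ a → i ≼ b → (e ! i) ≼ 1 + a + b
  !-costs (costs e≼) (costs i≼) = costs (1+-mono e≼ i≼)

  nil-costs : nil {τ = τ} ≼ 1
  nil-costs = costs ≤-refl

  cons-costs : {e : E τ} {e′ : E (list τ)} → e ≼ a → e′ ≼ b → cons e e′ ≼ 1 + a + b
  cons-costs (costs e≼) (costs e′≼) = costs (1+-mono e≼ e′≼)

  head-costs : {e : E (list τ)} → e ≼ a → head e ≼ 1 + a
  head-costs (costs e≼) = costs (s≤s e≼)

  tail-costs : {e : E (list τ)} → e ≼ a → tail e ≼ 1 + a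
  tail-costs (costs e≼) = costs (s≤s e≼)

  sum-applyUpTo-≤ : ∀ {g} → (∀ i → g i ≤ c) → ∀ m → List-sum (List.applyUpTo g m) ≤ m * c
  sum-applyUpTo-≤ g≤ zero    = z≤n
  sum-applyUpTo-≤ g≤ (suc m) = +-mono-≤ (g≤ 0) (sum-applyUpTo-≤ (g≤ ∘ suc) m)

  fill-costs : {e : E word} {f : ℕ → E τ} → e ≼ a → (∀ i → f i ≼ c) → fill e f ≼ 1 + a + value e * (1 + c)
  fill-costs {e = e} (costs e≼) f≼ = costs (1+-mono e≼ (sum-applyUpTo-≤ (λ i → s≤s (cost≤ (f≼ i))) (value e)))

  loop-costs : {e : E word} {z : E σ} {f : ℕ → ⟦ σ ⟧ → E σ} → e ≼ a → z ≼ b → (∀ i s → f i s ≼ c) →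
               loop e z f ≼ 1 + a + b + value e * (1 + c)
  loop-costs {e = e} (costs e≼) (costs z≼) f≼ =
    costs (s≤s (+-mono-≤ (+-mono-≤ e≼ z≼) (sum-applyUpTo-≤ (λ i → s≤s (cost≤ (f≼ i _))) (value e))))

  if-costs : ∀ v {e e′ : E τ} → e ≼ a → e′ ≼ b → (if v then e else e′) ≼ a ⊔ b
  if-costs {a = a} {b} true  (costs e≼) _ = costs (≤-trans e≼ (m≤m⊔n a b))
  if-costs {a = a} {b} false _ (costs e≼) = costs (≤-trans e≼ (m≤n⊔m a b))

  every-costs : {es : Fin m → E bool} → (∀ r → es r ≼ c) → every es ≼ 1 + m * (1 + c)
  every-costs {zero}  es≼ = costs ≤-refl
  every-costs {suc m} {c} es≼ = costs (≤-trans (cost≤ (cond-costs (es≼ zero) (every-costs (es≼ ∘ suc)) ff-costs))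
    -- The branch `ff′` costs 1, which the bound for the remaining conjuncts already dominates.
    (≤-reflexive (trans (cong (1 + c +_) (m≥n⇒m⊔n≡m (s≤s z≤n))) (+-suc (1 + c) _))))

  total-costs : {es : Fin m → E num} → (∀ r → es r ≼ c) → total es ≼ 1 + m * (1 + c)
  total-costs {zero}  es≼ = costs ≤-refl
  total-costs {suc m} {c} es≼ = costs (≤-trans (cost≤ (+′-costs (es≼ zero) (total-costs (es≼ ∘ suc))))
    (≤-reflexive (+-suc (1 + c) _)))

  select-costs : {t : E (Table m τ)} {is : Vec (E word) m} → t ≼ a → (∀ i → lookup is i ≼ c) →
                 select {τ = τ} t is ≼ a + m * (1 + c)
  select-costs {zero} {is = []} (costs t≼) is≼ = costs (≤-trans t≼ (m≤m+n _ 0))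
  select-costs {suc m} {a = a} {c} {is = i ∷ is} t≼ is≼ = costs
    (≤-trans (cost≤ (select-costs {is = is} (!-costs t≼ (is≼ zero)) (is≼ ∘ suc))) (≤-reflexive (regroup a c m)))
    where
    regroup : ∀ a c m → 1 + a + c + m * (1 + c) ≡ a + (1 + c + m * (1 + c))
    regroup = solve-∀

  -- Each of the m levels adds 1 + a for the loop and its bound and 1 per iteration. As B ≥ 1 these
  -- are charged to the B^m cells, which leaves a factor independent of B.
  fillAll-costs : ∀ m {b : E word} {f : Vec ℕ m → E τ} → 1 ≤ value b → b ≼ a → (∀ is → f is ≼ c) →
                  fillAll m b f ≼ value b ^ m * (c + m * (2 + a))
  fillAll-costs {c = c} zero {b} 1≤b b≼ f≼ = costs (≤-trans (cost≤ (f≼ [])) (≤-reflexive (regroup c)))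
    where
    regroup : ∀ c → c ≡ 1 * (c + 0)
    regroup = solve-∀
  fillAll-costs {a = a} {c} (suc m) {b} 1≤b b≼ f≼ = costs (begin
    _                                  ≤⟨ cost≤ (fill-costs b≼ (λ i → fillAll-costs m 1≤b b≼ (λ is → f≼ (i ∷ is)))) ⟩
    1 + a + B * (1 + B ^ m * d)        ≡⟨ regroup a B (B ^ m * d) ⟩
    (1 + a) * 1 + B * 1 + B * (B ^ m * d)
      ≤⟨ +-monoˡ-≤ _ (+-mono-≤ (*-monoʳ-≤ (1 + a) 1≤B^) (*-monoʳ-≤ B 1≤B^m)) ⟩
    (1 + a) * (B * B ^ m) + B * B ^ m + B * (B ^ m * d) ≡⟨ collect a B (B ^ m) c m ⟩
    B * B ^ m * (c + suc m * (2 + a))  ∎)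
    where
    open ≤-Reasoning
    B = value b
    d = c + m * (2 + a)
    1≤B^m : 1 ≤ B ^ m
    1≤B^m = m^n>0 B {{>-nonZero 1≤b}} m
    1≤B^ : 1 ≤ B * B ^ m
    1≤B^ = *-mono-≤ 1≤b 1≤B^m
    regroup : ∀ a B x → 1 + a + B * (1 + x) ≡ (1 + a) * 1 + B * 1 + B * x
    regroup = solve-∀
    collect : ∀ a B P c m → (1 + a) * (B * P) + B * P + B * (P * (c + m * (2 + a))) ≡ B * P * (c + suc m * (2 + a))
    collect = solve-∀

  -- Here a level costs 3 + a per cell: compared with `fillAll-costs`, each inner loop also reads
  -- its initial state.
  loopAll-costs : ∀ m {b : E word} {z : E σ} {f : Vec ℕ m → ⟦ σ ⟧ → E σ} {d} → 1 ≤ value b →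
                  b ≼ a → z ≼ d → (∀ is s → f is s ≼ c) →
                  loopAll m b z f ≼ value b ^ m * (1 + d + c + m * (3 + a))
  loopAll-costs {c = c} zero {d = d} 1≤b b≼ z≼ f≼ = costs (≤-trans (cost≤ (bind-costs z≼ (f≼ []))) (≤-reflexive (regroup d c)))
    where
    regroup : ∀ d c → 1 + d + c ≡ 1 * (1 + d + c + 0)
    regroup = solve-∀
  loopAll-costs {a = a} {c} (suc m) {b} {d = d} 1≤b b≼ z≼ f≼ = costs (begin
    _ ≤⟨ cost≤ (loop-costs b≼ z≼ (λ i s → loopAll-costs m 1≤b b≼ (var-costs {x = s}) (λ is → f≼ (i ∷ is)))) ⟩
    1 + a + d + B * (1 + B ^ m * (1 + 1 + c + m * (3 + a)))
      ≡⟨ regroup a d B (B ^ m * (1 + 1 + c + m * (3 + a))) ⟩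
    (1 + a + d) * 1 + B * 1 + B * (B ^ m * (1 + 1 + c + m * (3 + a)))
      ≤⟨ +-monoˡ-≤ _ (+-mono-≤ (*-monoʳ-≤ (1 + a + d) 1≤B^) (*-monoʳ-≤ B 1≤B^m)) ⟩
    (1 + a + d) * (B * B ^ m) + B * B ^ m + B * (B ^ m * (1 + 1 + c + m * (3 + a)))
      ≡⟨ collect a B (B ^ m) c d m ⟩
    B * B ^ m * (1 + d + c + suc m * (3 + a)) ∎)
    where
    open ≤-Reasoning
    B = value b
    1≤B^m : 1 ≤ B ^ m
    1≤B^m = m^n>0 B {{>-nonZero 1≤b}} m
    1≤B^ : 1 ≤ B * B ^ m
    1≤B^ = *-mono-≤ 1≤b 1≤B^m
    regroup : ∀ a d B x → 1 + a + d + B * (1 + x) ≡ (1 + a + d) * 1 + B * 1 + B * x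
    regroup = solve-∀
    collect : ∀ a B P c d m → (1 + a + d) * (B * P) + B * P + B * (P * (1 + 1 + c + m * (3 + a)))
              ≡ B * P * (1 + d + c + suc m * (3 + a))
    collect = solve-∀

-- Cost bounds for the parts of the program

module ProgramCosts (d-1 k : ℕ) where
  open CostRules

  private
    K = k ^ d-1

  -- The constants are left to unification: being solved outside the scope of R, n, ω and G, they
  -- depend on d-1 and k only.
  feasible-costs : ∃ λ c → ∀ {R} n ω G W → Costs R (Program.feasible d-1 k n ω G W) c
  feasible-costs = _ , λ n ω G W →
    every-costs λ r → every-costs λ r′ → every-costs λ i → if-costs _
      (cond-costs (≤ʷ-costs (proj-costs var-costs) lit-costs) tt-costs
      (cond-costs (≤ʷ-costs (+ʷ-costs (proj-costs var-costs) lit-costs) (proj-costs var-costs)) tt-costs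
      (cond-costs (≤ʷ-costs (+ʷ-costs (proj-costs var-costs) lit-costs) (proj-costs var-costs)) tt-costs
      (≤ʷ-costs var-costs lit-costs))))
      tt-costs

  -- The column is passed unevaluated, as a variable or as a variable plus one; the latter costs 3.
  feasibleAt-costs : ∃ λ c → ∀ {R} n ω G e W → Costs R e 3 → Costs R (Program.feasibleAt d-1 k n ω G e W) c
  feasibleAt-costs = _ , λ n ω G e W e≼ →
    cond-costs (proj₂ feasible-costs n ω G W)
      (every-costs λ r → cond-costs (≤ʷ-costs (proj-costs var-costs) lit-costs) tt-costs
        (cond-costs (≤′-costs (!-costs (proj-costs var-costs) (∸ʷ-costs (+ʷ-costs e≼ (proj-costs var-costs)) lit-costs)) zero-costs)
          ff-costs tt-costs))
      ff-costs

  entry-costs : ∀ {R} n ω G {t : Exp (Semantics.⟦_⟧ R) (Table K (num ⊗ word ⋆ K))} {a} W → Costs R t a →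
                Costs R (Program._‼_ d-1 k {Semantics.⟦_⟧ R} n ω G t W) (a + K * 3)
  entry-costs {R} n ω G W t≼ = select-costs {τ = num ⊗ word ⋆ K} {is = tabulate at} t≼ λ r →
    subst (λ e → Costs R e 2) (sym (lookup∘tabulate at r)) (proj-costs var-costs)
    where
    at : Fin K → Exp (Semantics.⟦_⟧ R) word
    at = Program.at d-1 k n ω G W

  lastColumn-costs : ∃ λ c → ∀ {R} n ω G W → Costs R (Program.lastColumn d-1 k n ω G W) c
  lastColumn-costs = _ , λ n ω G W →
    tuple-costs λ r → cond-costs (≤ʷ-costs var-costs (proj-costs var-costs)) one-costs zero-costs

  predecessor-costs : ∃ λ c → ∀ {R} n ω G W b → (∀ r → Costs R (b r) 1) →
                      Costs R (Program.predecessor d-1 k n ω G W b) c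
  predecessor-costs = _ , λ n ω G W b b≼ →
    tuple-costs λ r → cond-costs
      (cond-costs (≤ʷ-costs lit-costs (proj-costs var-costs))
        (≤ʷ-costs (+ʷ-costs (proj-costs var-costs) lit-costs) var-costs) ff-costs)
      (+ʷ-costs (proj-costs var-costs) lit-costs) (b≼ r)

  improve-costs : ∃ λ c → ∀ {R} n ω G e T W best → Costs R e 3 →
                  Costs R (Program.improve d-1 k n ω G e T W best) c
  improve-costs = _ , λ n ω G e T W best e≼ →
    cond-costs (proj₂ feasibleAt-costs n ω G e W e≼)
      (bind-costs (fst-costs (entry-costs n ω G W var-costs)) λ x →
        cond-costs (≤′-costs var-costs (fst-costs var-costs)) var-costs (pair-costs var-costs var-costs))
      var-costs

  -- The loop makes 2^K rounds, a number fixed by d and k, so its whole cost is a constant.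
  bestPredecessor-costs : ∃ λ c → ∀ {R} n ω G j T W → Costs R (Program.bestPredecessor d-1 k n ω G j T W) c
  bestPredecessor-costs = _ , λ n ω G j T W →
    loopAll-costs K (s≤s z≤n) lit-costs
      (bind-costs (proj₂ predecessor-costs n ω G W _ (λ r → lit-costs)) λ W₀ →
        pair-costs (fst-costs (entry-costs n ω G W₀ var-costs)) var-costs)
      (λ b best → bind-costs (proj₂ predecessor-costs n ω G W _ (λ r → var-costs)) λ W* →
        proj₂ improve-costs n ω G (var j) T W* best (weaken (s≤s z≤n) var-costs))

  gain-costs : ∃ λ c → ∀ {R} n ω G e W → Costs R e 3 → Costs R (Program.gain d-1 k n ω G e W) c
  gain-costs = _ , λ n ω G e W e≼ →
    bind-costs (proj₂ lastColumn-costs n ω G W) λ c → total-costs λ r →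
      *′-costs (proj-costs var-costs) (!-costs (proj-costs var-costs) (∸ʷ-costs (+ʷ-costs e≼ var-costs) lit-costs))

  allCodes-costs : ∀ {R τ} n ω G {f : Semantics.⟦_⟧ R (word ⋆ K) → Exp (Semantics.⟦_⟧ R) τ} {c} → (∀ W → Costs R (f W) c) →
                   Costs R (Program.allCodes d-1 k n ω G f) ((ω + 1) ^ K * (1 + (1 + K * 1) + c + K * 5))
  allCodes-costs n ω G f≼ = fillAll-costs K (m≤n+m 1 ω) (+ʷ-costs var-costs lit-costs) λ c →
    bind-costs (tuple-costs λ r → var-costs) f≼

  start-costs : ∃ λ c → ∀ {R} n ω G → Costs R (Program.start d-1 k n ω G) ((ω + 1) ^ K * c)
  start-costs = _ , λ n ω G →
    allCodes-costs n ω G λ W → pair-costs zero-costs (tuple-costs λ r → lit-costs)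

  step-costs : ∃ λ c → ∀ {R} n ω G j T → Costs R (Program.step d-1 k n ω G j T) ((ω + 1) ^ K * c)
  step-costs = _ , λ n ω G j T → allCodes-costs n ω G λ W →
    cond-costs (proj₂ feasibleAt-costs n ω G _ W (+ʷ-costs var-costs lit-costs))
      (bind-costs (proj₂ bestPredecessor-costs n ω G j T W) λ best →
        pair-costs (+′-costs (proj₂ gain-costs n ω G _ W (+ʷ-costs var-costs lit-costs)) (fst-costs var-costs))
          (snd-costs var-costs))
      (pair-costs zero-costs (tuple-costs λ r → lit-costs))

  finalCode-costs : ∃ λ c → ∀ {R} n ω G T → Costs R (Program.finalCode d-1 k n ω G T) (1 + (ω + 1) ^ K * c)
  finalCode-costs = _ , λ n ω G T → snd-costs (loopAll-costs K (m≤n+m 1 ω) (+ʷ-costs var-costs lit-costs)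
    (bind-costs (tuple-costs λ r → lit-costs) λ W₀ → pair-costs (fst-costs (entry-costs n ω G W₀ var-costs)) var-costs)
    (λ c best → bind-costs (tuple-costs λ r → var-costs) λ W →
      proj₂ improve-costs n ω G (var n) T W best (weaken (s≤s z≤n) var-costs)))

  retrieval-costs : ∃ λ a → ∃ λ c → ∀ {R} n ω G Ts W → Costs R (Program.retrieval d-1 k n ω G Ts W) (a + (n ∸ 1) * c)
  retrieval-costs = _ , _ , λ n ω G Ts W → snd-costs (snd-costs (loop-costs (∸ʷ-costs var-costs lit-costs)
    (pair-costs var-costs (pair-costs var-costs (cons-costs (proj₂ lastColumn-costs n ω G W) nil-costs)))
    λ _ s →
      bind-costs (fst-costs var-costs) λ Ts′ →
      bind-costs (fst-costs (snd-costs var-costs)) λ W₁ →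
      bind-costs (snd-costs (entry-costs n ω G W₁ (head-costs var-costs))) λ W₂ →
      pair-costs (tail-costs var-costs) (pair-costs var-costs
        (cons-costs (proj₂ lastColumn-costs n ω G W₂) (snd-costs (snd-costs var-costs))))))

  algorithm-costs : ∃ λ c → ∀ {R} n ω G → 1 ≤ n →
                    Costs R (Program.algorithm d-1 k n ω G) (c * (n * (ω + 1) ^ K))
  -- The sum of the coefficients in `regroup`; each of the monomials 1, P, n, n * P and n - 1 is at
  -- most n * P, where P = (ω + 1)^K.
  algorithm-costs = 10 + a + (cs + cf) + 6 + ct + cr , λ {R} n ω G 1≤n →
    weaken (bound n ω 1≤n)
      (bind-costs
        (loop-costs var-costs (cons-costs (proj₂ start-costs n ω G) nil-costs) λ j Ts →
          bind-costs (head-costs var-costs) λ T → cons-costs (proj₂ step-costs n ω G j T) var-costs)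
        λ Ts → bind-costs (head-costs var-costs) λ T →
          bind-costs (proj₂ finalCode-costs n ω G T) λ W* → proj₂ (proj₂ retrieval-costs) n ω G Ts W*)
    where
    a = proj₁ retrieval-costs
    cr = proj₁ (proj₂ retrieval-costs)
    cs = proj₁ start-costs
    ct = proj₁ step-costs
    cf = proj₁ finalCode-costs
    regroup : ∀ n m P cs ct cf a cr →
      1 + (1 + 1 + (1 + P * cs + 1) + n * (1 + (1 + 2 + (1 + P * ct + 1)))) + (1 + 2 + (1 + (1 + P * cf) + (a + m * cr)))
      ≡ (10 + a) * 1 + (cs + cf) * P + 6 * n + ct * (n * P) + cr * m
    regroup = solve-∀
    collect : ∀ X cs ct cf a cr →
      (10 + a) * X + (cs + cf) * X + 6 * X + ct * X + cr * X ≡ (10 + a + (cs + cf) + 6 + ct + cr) * X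
    collect = solve-∀
    bound : ∀ n ω → 1 ≤ n → let P = (ω + 1) ^ K in
      1 + (1 + 1 + (1 + P * cs + 1) + n * (1 + (1 + 2 + (1 + P * ct + 1)))) + (1 + 2 + (1 + (1 + P * cf) + (a + (n ∸ 1) * cr)))
      ≤ (10 + a + (cs + cf) + 6 + ct + cr) * (n * P)
    bound n ω 1≤n = begin
      _                                                                  ≡⟨ regroup n (n ∸ 1) P cs ct cf a cr ⟩
      (10 + a) * 1 + (cs + cf) * P + 6 * n + ct * (n * P) + cr * (n ∸ 1)
        ≤⟨ +-mono-≤ (+-mono-≤ (+-mono-≤ (+-mono-≤ (*-monoʳ-≤ (10 + a) 1≤X) (*-monoʳ-≤ (cs + cf) P≤X)) (*-monoʳ-≤ 6 n≤X))
             (≤-refl {ct * (n * P)})) (*-monoʳ-≤ cr (≤-trans (m∸n≤m n 1) n≤X)) ⟩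
      (10 + a) * X + (cs + cf) * X + 6 * X + ct * X + cr * X             ≡⟨ collect X cs ct cf a cr ⟩
      (10 + a + (cs + cf) + 6 + ct + cr) * X                             ∎
      where
      open ≤-Reasoning
      P = (ω + 1) ^ K
      X = n * P
      instance
        ω+1≢0 : NonZero (ω + 1)
        ω+1≢0 = >-nonZero (m≤n+m 1 ω)
        P≢0 : NonZero P
        P≢0 = m^n≢0 (ω + 1) K
        n≢0 : NonZero n
        n≢0 = >-nonZero 1≤n
      n≤X : n ≤ X
      n≤X = m≤m*n n P
      P≤X : P ≤ X
      P≤X = m≤n*m P n
      1≤X : 1 ≤ X
      1≤X = ≤-trans 1≤n n≤X

  time-bound : .{{_ : NonZero k}} → ∃ λ C → ∀ {R} n-1 ω-1 (G : LoSNetwork R d-1 k (suc n-1) (suc ω-1)) →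
               TimeBound C d-1 k (suc n-1) (suc ω-1) (Execution.time G)
  time-bound = c * 2 ^ K , λ n-1 ω-1 G → bound n-1 ω-1 (cost≤ (proj₂ algorithm-costs (suc n-1) (suc ω-1) (Execution.input G) (s≤s z≤n)))
    where
    c = proj₁ algorithm-costs
    bound : ∀ n-1 ω-1 {t} → t ≤ c * (suc n-1 * (suc ω-1 + 1) ^ K) → TimeBound (c * 2 ^ K) d-1 k (suc n-1) (suc ω-1) t
    -- The linear bound is raised to the power ω, and the factor K^K, the ω-th power of k^((d-1)/ω)
    -- raised to K, is at least 1 because k is positive.
    bound n-1 ω-1 {t} t≤ = ≤-trans (^-monoˡ-≤ ω linear) (m≤m*n _ (K ^ K))
      where
      open ≤-Reasoning
      n = suc n-1
      ω = suc ω-1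
      instance
        K≢0 : NonZero K
        K≢0 = m^n≢0 k d-1
        K^K≢0 : NonZero (K ^ K)
        K^K≢0 = m^n≢0 K K
      ω+1≤2ω : ω + 1 ≤ 2 * ω
      ω+1≤2ω = ℕ-+-monoʳ-≤ ω (s≤s z≤n)
      regroup : ∀ c n x y → c * (n * (x * y)) ≡ c * x * n * y
      regroup = solve-∀
      linear : t ≤ c * 2 ^ K * n * ω ^ K
      linear = begin
        t                            ≤⟨ t≤ ⟩
        c * (n * (ω + 1) ^ K)        ≤⟨ *-monoʳ-≤ c (*-monoʳ-≤ n (^-monoˡ-≤ K ω+1≤2ω)) ⟩
        c * (n * (2 * ω) ^ K)        ≡⟨ cong (λ x → c * (n * x)) (^-distribʳ-* K 2 ω) ⟩
        c * (n * (2 ^ K * ω ^ K))    ≡⟨ regroup c n (2 ^ K) (ω ^ K) ⟩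
        c * 2 ^ K * n * ω ^ K        ∎

theorem1 : (d-1 k : ℕ) .{{_ : NonZero k}} →
    ∃ λ (C : ℕ) →
    (R : OrderedRing) (n-1 ω-1 : ℕ) (G : LoSNetwork R d-1 k (suc n-1) (suc ω-1)) →
    ((ρ : Run G) → NetworkArray.MarksMaximumIndependentSet G (Run.output ρ))
    × (∃ λ (ρ : Run G) → Execution.result G ≡ toList (Run.output ρ))
    × TimeBound C d-1 k (suc n-1) (suc ω-1) (Execution.time G)
theorem1 d-1 k = proj₁ time-bound , λ R n-1 ω-1 G →
    RunProperties.output-correct G
  , (Implementation.run G , Implementation.result≡ G)
  , proj₂ time-bound n-1 ω-1 G
  where open ProgramCosts d-1 k
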